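{- Let $R\geq 4$ and let $q\geq 4$ be a prime power. Then there exists a linear $[n,n-2R,3]_q$ code with $n=Rq+\lceil R/3\rceil$ and covering radius $R$ which is an $(R,\ell)$-object for some $\ell\geq 1$.
   Context: An $[n,n-r,d]_q$ code is a linear subspace of $F_q^n$ of dimension $n-r$ and minimum Hamming distance $d$; it has covering radius $R$ if every column of $F_q^{r}$ is a linear combination of at most $R$ columns of a parity-check matrix $\mathbf{H}$, with $R$ minimal. For $0\leq\ell\leq R$, a partition of the column set of $\mathbf{H}$ into nonempty subsets is an $(R,\ell)$-partition if every column of $F_q^{r}$ (including the zero column) equals a linear combination with nonzero coefficients of at least $\ell$ and at most $R$ columns of $\mathbf{H}$ belonging to distinct subsets. The code is an $(R,\ell)$-object if some parity-check matrix of it admits an $(R,\ell)$-partition. -}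

module Defs where

open import Level using (Level; _⊔_)
open import Data.Nat using (ℕ; zero; suc; _≤_)
import Data.Nat as ℕ
open import Data.Fin using (Fin)
import Data.Fin as Fin
open import Data.Fin.Subset using (Subset; _∈_; _∉_; ∣_∣)
open import Data.Product using (Σ; ∃; _×_; _,_)
open import Relation.Nullary using (¬_)
open import Relation.Binary.PropositionalEquality using (_≡_)
import Relation.Binary.PropositionalEquality as ≡
open import Function.Bundles using (Inverse)
open import Algebra.Bundles using (CommutativeRing)

record Field (c ℓ : Level) : Set (Level.suc (c ⊔ ℓ)) where
  field
    commRing : CommutativeRing c ℓ
  open CommutativeRing commRing public
  field
    1≉0     : ¬ (1# ≈ 0#)
    inverse : ∀ x → ¬ (x ≈ 0#) → ∃ λ y → (x * y) ≈ 1#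

record FiniteField (c ℓ : Level) (q : ℕ) : Set (Level.suc (c ⊔ ℓ)) where
  field
    field′ : Field c ℓ
  open Field field′ public
  field
    enum : Inverse setoid (≡.setoid (Fin q))

module CodeDefs {c ℓ : Level} {q : ℕ} (F : FiniteField c ℓ q) where
  open FiniteField F

  ∑ : ∀ {n} → (Fin n → Carrier) → Carrier
  ∑ {zero}  f = 0#
  ∑ {suc n} f = f Fin.zero + ∑ (λ j → f (Fin.suc j))

  Matrix : ℕ → ℕ → Set c
  Matrix r n = Fin r → Fin n → Carrier

  Vector : ℕ → Set c
  Vector n = Fin n → Carrier

  _·_ : ∀ {r n} → Matrix r n → Vector n → Vector r
  (H · x) i = ∑ (λ j → H i j * x j)

  _≈ᵥ_ : ∀ {n} → Vector n → Vector n → Set ℓ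
  u ≈ᵥ v = ∀ i → u i ≈ v i

  0ᵥ : ∀ {n} → Vector n
  0ᵥ _ = 0#

  FullRowRank : ∀ {r n} → Matrix r n → Set (c ⊔ ℓ)
  FullRowRank {r} {n} H =
    ∀ (a : Vector r) → (∀ j → ∑ (λ i → a i * H i j) ≈ 0#) → ∀ i → a i ≈ 0#

  Codeword : ∀ {r n} → Matrix r n → Vector n → Set ℓ
  Codeword H x = (H · x) ≈ᵥ 0ᵥ

  SupportedOn : ∀ {n} → Vector n → Subset n → Set ℓ
  SupportedOn x S = ∀ j → j ∉ S → x j ≈ 0#

  WeightAtMost : ∀ {n} → ℕ → Vector n → Set ℓ
  WeightAtMost {n} k x = Σ (Subset n) λ S → ∣ S ∣ ≤ k × SupportedOn x S

  Nonzero : ∀ {n} → Vector n → Set ℓ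
  Nonzero x = ¬ (x ≈ᵥ 0ᵥ)

  MinDistance : ∀ {r n} → Matrix r n → ℕ → Set (c ⊔ ℓ)
  MinDistance {r} {n} H d =
    (∀ (x : Vector n) → Codeword H x → Nonzero x → ∀ k → WeightAtMost k x → d ≤ k)
    × Σ (Vector n) (λ x → Codeword H x × Nonzero x × WeightAtMost d x)

  CombAtMost : ∀ {r n} → Matrix r n → ℕ → Vector r → Set (c ⊔ ℓ)
  CombAtMost {r} {n} H k v =
    Σ (Subset n) λ S → ∣ S ∣ ≤ k ×
      Σ (Vector n) λ a → SupportedOn a S × (H · a) ≈ᵥ v

  CoveringRadius : ∀ {r n} → Matrix r n → ℕ → Set (c ⊔ ℓ)
  CoveringRadius {r} {n} H R =
    (∀ (v : Vector r) → CombAtMost H R v)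
    × (∀ R′ → (∀ (v : Vector r) → CombAtMost H R′ v) → R ≤ R′)

  record Partition (n : ℕ) : Set where
    field
      m        : ℕ
      part     : Fin n → Fin m
      nonempty : ∀ (t : Fin m) → ∃ λ j → part j ≡ t

  IsRlPartition : ∀ {r n} → Matrix r n → ℕ → ℕ → Partition n → Set (c ⊔ ℓ)
  IsRlPartition {r} {n} H R l P =
    ∀ (v : Vector r) → Σ (Subset n) λ S →
      l ≤ ∣ S ∣ × ∣ S ∣ ≤ R ×
      (∀ j k → j ∈ S → k ∈ S → Partition.part P j ≡ Partition.part P k → j ≡ k) ×
      Σ (Vector n) λ a →
        (∀ j → j ∈ S → ¬ (a j ≈ 0#)) × SupportedOn a S × (H · a) ≈ᵥ v

  -- the code with parity-check matrix H is an (R,l)-object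
  -- (witnessed by this parity-check matrix)
  RlObject : ∀ {r n} → Matrix r n → ℕ → ℕ → Set (c ⊔ ℓ)
  RlObject {r} {n} H R l = l ≤ R × Σ (Partition n) (IsRlPartition H R l)

ceil3 : ℕ → ℕ
ceil3 R = (R ℕ.+ 2) ℕ./ 3

{-# OPTIONS --safe #-}

-- The 2R rows are grouped into R pairs (leading, trailing).  Pair o carries the
-- q columns with leading entry 1 and trailing entry a ∈ F_q: a line without its
-- point at infinity (0 , 1).  These missing points are what remains to be covered.
-- Pairs are chained in groups of two or three: all pairs of a chain but the last
-- also get the entry a² in the trailing row of the next pair, which bends the line
-- into a conic, and each chain gets one further column, the point at infinity of
-- its first pair.  Through any point of the plane of such a conic with nonzero
-- leading coordinate passes a secant (here q ≥ 4 is used), so that two points of one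
-- pair do the work of a missing point of the next; a case distinction on the
-- vanishing leading coordinates shows that a chain of length k has covering radius
-- at most k.  A direct sum of chains of length 3 and at most two of length 2 has
-- length Rq + ⌈R/3⌉.  No column meets two leading rows, so the vector of ones takes
-- R columns; three points of a line give a codeword of weight 3, which also
-- represents the zero column in the partition into singletons.
module Submission where

open import Defs
open import Level using (Level; _⊔_; 0ℓ)
import Level
open import Algebra.Bundles using (CommutativeRing)
import Algebra.Properties.AbelianGroup
import Algebra.Properties.CommutativeSemigroup
import Algebra.Properties.Ring
import Algebra.Properties.Semiring.Mult.TCOptimised
import Algebra.Properties.Semiring.Sum
import Algebra.Solver.Ring
open import Algebra.Solver.Ring.AlmostCommutativeRing
  using (_-Raw-AlmostCommutative⟶_; fromCommutativeRing)
open import Data.Bool using (if_then_else_; not)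
open import Data.Fin using (Fin; zero; suc; _↑ˡ_; punchIn)
open import Data.Fin.Patterns using (0F; 1F; 2F)
import Data.Fin.Properties as Fin
open import Data.Fin.Subset
  using (Subset; inside; outside; ⊥; ⁅_⁆; _∪_; _∈_; ∣_∣)
import Data.Fin.Subset.Properties as Subset
open import Data.Integer using (ℤ; +_; -[1+_]; _⊖_)
import Data.Integer as ℤ
import Data.Integer.Properties as ℤ
open import Data.List using (List; []; _∷_; _++_; length; map)
import Data.List.Properties as List
open import Data.List.Relation.Unary.All using (All; []; _∷_)
import Data.List.Relation.Unary.All as All
import Data.List.Relation.Unary.All.Properties as All
open import Data.List.Relation.Unary.AllPairs using ([]; _∷_)
open import Data.List.Relation.Unary.Unique.Propositional using (Unique)
import Data.List.Relation.Unary.Unique.Propositional.Properties as Unique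
import Data.Maybe as Maybe
open import Data.Nat using (ℕ; zero; suc; _≤_; z≤n; s≤s; _≤?_)
import Data.Nat as ℕ
import Data.Nat.DivMod as ℕ
import Data.Nat.Properties as ℕ
open import Data.Product using (Σ; ∃; _×_; _,_; proj₁; proj₂; map₂)
open import Data.Product.Function.NonDependent.Propositional using (_×-↔_)
open import Data.Sum using (_⊎_; inj₁; inj₂)
import Data.Sum as Sum
open import Data.Sum.Function.Propositional using (_⊎-↔_)
import Data.Sum.Properties as Sum
open import Data.Unit using (⊤; tt)
import Data.Vec as Vec
import Data.Vec.Properties as Vec
open import Function using (_∘_; id; Inverse; _↔_)
open import Function.Properties.Inverse using (↔-refl; ↔-trans)
open import Relation.Binary.Definitions using (DecidableEquality)
open import Relation.Binary.PropositionalEquality using (_≡_; _≢_; cong)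
import Relation.Binary.PropositionalEquality as ≡
import Relation.Binary.Reasoning.Setoid as SetoidReasoning
open import Relation.Nullary using (¬_; Dec; yes; no; does; contradiction)
open import Relation.Nullary.Decidable
  using (True; toWitness; map′; dec⇒maybe; dec-true; dec-false; decidable-stable; _⊎-dec_)

-- Polynomial identities with integer coefficients in a commutative ring.

module IntegerSolver {c ℓ} (R : CommutativeRing c ℓ) where
  open CommutativeRing R hiding (zero)
  open Algebra.Properties.Ring ring
  open Algebra.Properties.AbelianGroup +-abelianGroup using (⁻¹-∙-comm)
  open Algebra.Properties.CommutativeSemigroup
    (CommutativeRing.+-commutativeSemigroup R) using (interchange)
  open Algebra.Properties.Semiring.Mult.TCOptimised semiring
    using (1+×; ×1-homo-*; ×-homo-+) renaming (_×_ to _·_)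
  open SetoidReasoning setoid

  -- The canonical homomorphism from the integers, which have decidable equality of coefficients.
  -- With the optimised multiples, `1 · 1#` is `1#` by definition, so solver terms with `con (+ 1)`
  -- match goals stated with `1#`.
  ⟦_⟧ : ℤ → Carrier
  ⟦ + n ⟧      = n · 1#
  ⟦ -[1+ n ] ⟧ = - (suc n · 1#)

  ⟦-⟧ : ∀ i → ⟦ ℤ.- i ⟧ ≈ - ⟦ i ⟧
  ⟦-⟧ (+ zero)  = sym -0#≈0#
  ⟦-⟧ (+ suc n) = refl
  ⟦-⟧ -[1+ n ]  = sym (-‿involutive _)

  ⟦⊖⟧ : ∀ m n → ⟦ m ⊖ n ⟧ ≈ (m · 1#) - (n · 1#)
  ⟦⊖⟧ m zero = begin
    ⟦ m ⊖ 0 ⟧       ≡⟨ cong ⟦_⟧ (ℤ.⊖-≥ {m} ℕ.z≤n) ⟩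
    m · 1#          ≈⟨ +-identityʳ _ ⟨
    m · 1# + 0#     ≈⟨ +-congˡ -0#≈0# ⟨
    m · 1# - 0#     ∎
  ⟦⊖⟧ zero (suc n) = sym (+-identityˡ _)
  ⟦⊖⟧ (suc m) (suc n) = begin
    ⟦ suc m ⊖ suc n ⟧                  ≡⟨ cong ⟦_⟧ (ℤ.[1+m]⊖[1+n]≡m⊖n m n) ⟩
    ⟦ m ⊖ n ⟧                          ≈⟨ ⟦⊖⟧ m n ⟩
    m · 1# - n · 1#                    ≈⟨ +-identityˡ _ ⟨
    0# + (m · 1# - n · 1#)             ≈⟨ +-congʳ (-‿inverseʳ 1#) ⟨
    (1# - 1#) + (m · 1# - n · 1#)      ≈⟨ interchange _ _ _ _ ⟩
    (1# + m · 1#) + (- 1# - n · 1#)    ≈⟨ +-congˡ (⁻¹-∙-comm _ _) ⟩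
    (1# + m · 1#) - (1# + n · 1#)      ≈⟨ +-cong (1+× m 1#) (-‿cong (1+× n 1#)) ⟨
    suc m · 1# - suc n · 1#            ∎

  ⟦+⟧ : ∀ i j → ⟦ i ℤ.+ j ⟧ ≈ ⟦ i ⟧ + ⟦ j ⟧
  ⟦+⟧ (+ m) (+ n) = ×-homo-+ 1# m n
  ⟦+⟧ (+ m) -[1+ n ] = ⟦⊖⟧ m (suc n)
  ⟦+⟧ -[1+ m ] (+ n) = trans (⟦⊖⟧ n (suc m)) (+-comm _ _)
  ⟦+⟧ -[1+ m ] -[1+ n ] = begin
    - (suc (suc (m ℕ.+ n)) · 1#)         ≡⟨ cong (λ k → - (suc k · 1#)) (ℕ.+-suc m n) ⟨
    - ((suc m ℕ.+ suc n) · 1#)           ≈⟨ -‿cong (×-homo-+ 1# (suc m) (suc n)) ⟩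
    - (suc m · 1# + suc n · 1#)        ≈⟨ ⁻¹-∙-comm _ _ ⟨
    - (suc m · 1#) - (suc n · 1#)      ∎

  ⟦pos*⟧ : ∀ m j → ⟦ + m ℤ.* j ⟧ ≈ m · 1# * ⟦ j ⟧
  ⟦pos*⟧ m (+ n) = trans (reflexive (cong ⟦_⟧ (≡.sym (ℤ.pos-* m n)))) (×1-homo-* m n)
  ⟦pos*⟧ m -[1+ n ] = begin
    ⟦ + m ℤ.* -[1+ n ] ⟧               ≡⟨ cong ⟦_⟧ (ℤ.neg-distribʳ-* (+ m) (+ suc n)) ⟨
    ⟦ ℤ.- (+ m ℤ.* + suc n) ⟧          ≈⟨ ⟦-⟧ (+ m ℤ.* + suc n) ⟩
    - ⟦ + m ℤ.* + suc n ⟧              ≈⟨ -‿cong (⟦pos*⟧ m (+ suc n)) ⟩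
    - (m · 1# * suc n · 1#)            ≈⟨ -‿distribʳ-* _ _ ⟩
    m · 1# * - (suc n · 1#)            ∎

  ⟦*⟧ : ∀ i j → ⟦ i ℤ.* j ⟧ ≈ ⟦ i ⟧ * ⟦ j ⟧
  ⟦*⟧ (+ m)    j = ⟦pos*⟧ m j
  ⟦*⟧ -[1+ m ] j = begin
    ⟦ -[1+ m ] ℤ.* j ⟧                 ≡⟨ cong ⟦_⟧ (ℤ.neg-distribˡ-* (+ suc m) j) ⟨
    ⟦ ℤ.- (+ suc m ℤ.* j) ⟧            ≈⟨ ⟦-⟧ (+ suc m ℤ.* j) ⟩
    - ⟦ + suc m ℤ.* j ⟧                ≈⟨ -‿cong (⟦pos*⟧ (suc m) j) ⟩
    - (suc m · 1# * ⟦ j ⟧)             ≈⟨ -‿distribˡ-* _ _ ⟩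
    - (suc m · 1#) * ⟦ j ⟧             ∎

  morphism : ℤ.+-*-rawRing -Raw-AlmostCommutative⟶ fromCommutativeRing R
  morphism = record
    { ⟦_⟧    = ⟦_⟧
    ; +-homo = ⟦+⟧
    ; *-homo = ⟦*⟧
    ; -‿homo = ⟦-⟧
    ; 0-homo = refl
    ; 1-homo = refl
    }

  open Algebra.Solver.Ring ℤ.+-*-rawRing (fromCommutativeRing R) morphism
    (λ i j → Maybe.map (λ i≡j → reflexive (cong ⟦_⟧ i≡j)) (dec⇒maybe (i ℤ.≟ j)))
    public using (solve; con; _:=_; _:+_; _:*_; _:-_; :-_)

-- Finite fields with at least four elements, and weighted sums over lists.

three-others : ∀ {n} → 4 ≤ n → (i : Fin n) →
  Σ (Fin 3 → Fin n) λ f → (∀ k → f k ≢ i) × (∀ {k l} → f k ≡ f l → k ≡ l)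
-- `punchIn i` skips exactly `i`, and the bound leaves at least three values in its domain.
three-others (s≤s (s≤s (s≤s (s≤s {n = m} _)))) i =
    (λ k → punchIn i (k ↑ˡ m))
  , (λ k → Fin.punchInᵢ≢i i (k ↑ˡ m))
  , (λ {k} {l} eq → Fin.↑ˡ-injective m k l (Fin.punchIn-injective i _ _ eq))

module FieldProperties {c ℓ q} (F : FiniteField c ℓ q) where
  open FiniteField F hiding (zero)
  open IntegerSolver commRing
  open Algebra.Properties.AbelianGroup +-abelianGroup using (x∙y⁻¹≈ε⇒x≈y)
  open SetoidReasoning setoid

  infix 4 _≟_

  index : Carrier → Fin q
  index = Inverse.to enum

  element : Fin q → Carrier
  element = Inverse.from enum

  element-index : ∀ x → element (index x) ≈ x
  element-index = Inverse.strictlyInverseʳ enum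

  element-injective : ∀ {i j} → element i ≈ element j → i ≡ j
  element-injective {i} {j} eq = ≡.trans (≡.sym (Inverse.strictlyInverseˡ enum i))
    (≡.trans (Inverse.to-cong enum eq) (Inverse.strictlyInverseˡ enum j))

  _≟_ : ∀ x y → Dec (x ≈ y)
  x ≟ y = map′
    (λ eq → trans (sym (element-index x))
              (trans (Inverse.from-cong enum eq) (element-index y)))
    (Inverse.to-cong enum) (index x Fin.≟ index y)

  x-y≈0⇒x≈y : ∀ {x y} → x - y ≈ 0# → x ≈ y
  x-y≈0⇒x≈y = x∙y⁻¹≈ε⇒x≈y _ _

  x≈y⇒x-y≈0 : ∀ {x y} → x ≈ y → x - y ≈ 0#
  x≈y⇒x-y≈0 x≈y = trans (+-congʳ x≈y) (-‿inverseʳ _)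

  -- Reduces an equation to a polynomial identity with an explicit cofactor k
  -- of the hypothesis e ≈ f.
  modulo : ∀ {x y k e f} → e ≈ f → x ≈ y + k * (e - f) → x ≈ y
  modulo {x} {y} {k} {e} {f} e≈f eq = begin
    x                 ≈⟨ eq ⟩
    y + k * (e - f)   ≈⟨ +-congˡ (*-congˡ (x≈y⇒x-y≈0 e≈f)) ⟩
    y + k * 0#        ≈⟨ +-congˡ (zeroʳ k) ⟩
    y + 0#            ≈⟨ +-identityʳ y ⟩
    y                 ∎

  xy≈0⇒y≈0 : ∀ {x y} → x ≉ 0# → x * y ≈ 0# → y ≈ 0#
  xy≈0⇒y≈0 {x} {y} x≉0 xy≈0 with inverse x x≉0
  ... | x⁻¹ , xx⁻¹≈1 = modulo xy≈0 (modulo xx⁻¹≈1 (solve 3 (λ x y z →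
          y := (con (+ 0) :+ z :* (x :* y :- con (+ 0))) :+ (:- y) :* (x :* z :- con (+ 1)))
          refl x y x⁻¹))

  xy≉0 : ∀ {x y} → x ≉ 0# → y ≉ 0# → x * y ≉ 0#
  xy≉0 x≉0 y≉0 xy≈0 = y≉0 (xy≈0⇒y≈0 x≉0 xy≈0)

  module _ (4≤q : 4 ≤ q) where

    abstract
      -- Two distinct roots a, b satisfy a + b ≈ u + u, so there is no third one.
      nonroot : ∀ u w → ∃ λ a → (u - a ≉ 0#) × (a * a - (u * a + u * a) + w ≉ 0#)
      nonroot u w with three-others 4≤q (index u)
      ... | f , f≢u , f-inj = choose (root? zero) (root? (suc zero))
        where
        e : Fin 3 → Carrier
        e = element ∘ f

        u≉e : ∀ k → u - e k ≉ 0#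
        u≉e k eq = f≢u k (element-injective
          (trans (sym (x-y≈0⇒x≈y eq)) (sym (element-index u))))

        Root : Carrier → Set ℓ
        Root a = a * a - (u * a + u * a) + w ≈ 0#

        root? : ∀ k → Dec (Root (e k))
        root? k = _ ≟ _

        -- Subtracting the two quadratic equations leaves (a - b)(a + b - 2u) = 0.
        root-sum : ∀ {k l} → k ≢ l → Root (e k) → Root (e l) → e k + e l - (u + u) ≈ 0#
        root-sum {k} {l} k≢l rk rl = xy≈0⇒y≈0 {e k - e l}
          (λ eq → k≢l (f-inj (element-injective (x-y≈0⇒x≈y eq))))
          (modulo rk (modulo rl (solve 4 (λ a b u w →
            (a :- b) :* (a :+ b :- (u :+ u)) :=
            (con (+ 0) :+ con (+ 1) :* (a :* a :- (u :* a :+ u :* a) :+ w :- con (+ 0)))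
              :+ (:- con (+ 1)) :* (b :* b :- (u :* b :+ u :* b) :+ w :- con (+ 0)))
            refl (e k) (e l) u w)))

        choose : Dec (Root (e zero)) → Dec (Root (e (suc zero))) →
          ∃ λ a → (u - a ≉ 0#) × ¬ Root a
        choose (no ¬r) _       = e zero , u≉e zero , ¬r
        choose (yes _) (no ¬r) = e (suc zero) , u≉e (suc zero) , ¬r
        -- A third root would have the same sum 2u with the first root as the second has, hence
        -- would equal the second.
        choose (yes r₀) (yes r₁) = e (suc (suc zero)) , u≉e (suc (suc zero)) , λ r₂ →
          contradiction (f-inj (element-injective (modulo (root-sum {zero} {suc zero} (λ ()) r₀ r₁)
            (modulo (root-sum {zero} {suc (suc zero)} (λ ()) r₀ r₂) (solve 4 (λ a b c u →
              b := (c :+ con (+ 1) :* (a :+ b :- (u :+ u) :- con (+ 0)))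
                     :+ (:- con (+ 1)) :* (a :+ c :- (u :+ u) :- con (+ 0)))
              refl (e zero) (e (suc zero)) (e (suc (suc zero))) u))))) λ ()

      -- For u = 1 and w = 0 the quadratic of `nonroot` is t² - 2t, which vanishes at t = 0; so a
      -- nonroot is nonzero, and `nonroot` already keeps it away from u = 1.
      third-element : ∃ λ t → (t ≉ 0#) × (t - 1# ≉ 0#)
      third-element with nonroot 1# 0#
      ... | t , 1≉t , ¬root =
          t
        , (λ t≈0 → ¬root (modulo t≈0 (solve 1 (λ t →
            t :* t :- (con (+ 1) :* t :+ con (+ 1) :* t) :+ con (+ 0)
              := con (+ 0) :+ (t :- con (+ 2)) :* (t :- con (+ 0))) refl t)))
        , (λ eq → 1≉t (modulo eq (solve 1 (λ t →
            con (+ 1) :- t := con (+ 0) :+ (:- con (+ 1)) :* (t :- con (+ 1) :- con (+ 0)))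
              refl t)))

  -- Lists may repeat a point, so that combinations can be concatenated without a disjointness
  -- condition; the length bounds the number of distinct columns.
  combine : ∀ {a} {A : Set a} → (A → Carrier) → List (Carrier × A) → Carrier
  combine f []             = 0#
  combine f ((k , x) ∷ xs) = k * f x + combine f xs

  module _ {a} {A : Set a} where

    combine-cong : ∀ {f g : A → Carrier} → (∀ x → f x ≈ g x) → ∀ xs → combine f xs ≈ combine g xs
    combine-cong f≈g []       = refl
    combine-cong f≈g (x ∷ xs) = +-cong (*-congˡ (f≈g _)) (combine-cong f≈g xs)

    combine-++ : ∀ (f : A → Carrier) xs ys → combine f (xs ++ ys) ≈ combine f xs + combine f ys
    combine-++ f []       ys = sym (+-identityˡ _)
    combine-++ f (x ∷ xs) ys = trans (+-congˡ (combine-++ f xs ys)) (sym (+-assoc _ _ _))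

    combine-+ : ∀ (f g : A → Carrier) xs → combine (λ x → f x + g x) xs ≈ combine f xs + combine g xs
    combine-+ f g []             = sym (+-identityˡ _)
    combine-+ f g ((k , x) ∷ xs) = trans (+-congˡ (combine-+ f g xs))
      (solve 5 (λ k a b c d → k :* (a :+ b) :+ (c :+ d) := (k :* a :+ c) :+ (k :* b :+ d))
        refl k (f x) (g x) (combine f xs) (combine g xs))

    combine-* : ∀ s (f : A → Carrier) xs → combine (λ x → s * f x) xs ≈ s * combine f xs
    combine-* s f []             = sym (zeroʳ s)
    combine-* s f ((k , x) ∷ xs) = trans (+-congˡ (combine-* s f xs))
      (solve 4 (λ s k a b → k :* (s :* a) :+ s :* b := s :* (k :* a :+ b))
        refl s k (f x) (combine f xs))

    combine-0 : ∀ xs → combine (λ (_ : A) → 0#) xs ≈ 0#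
    combine-0 []       = refl
    combine-0 (x ∷ xs) = trans (+-cong (zeroʳ _) (combine-0 xs)) (+-identityʳ _)

    combine-map : ∀ {b} {B : Set b} (f : A → Carrier) (g : B → A) xs →
      combine f (map (map₂ g) xs) ≡ combine (f ∘ g) xs
    combine-map f g []             = ≡.refl
    combine-map f g ((k , x) ∷ xs) = cong (_+_ (k * f (g x))) (combine-map f g xs)

-- Vectors as short combinations of points on a conic.

module Arcs {c ℓ q} (F : FiniteField c ℓ q) where
  open FiniteField F hiding (zero)
  open IntegerSolver commRing
  open FieldProperties F

  -- The vector (p, x, y) in the span of at most n affine points (1, a, a²) of a conic: p, x and y
  -- are the moments of order 0, 1 and 2 of a weighted set of parameters.
  Arc : ℕ → Carrier → Carrier → Carrier → Set (c ⊔ ℓ)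
  Arc n p x y = ∃ λ ts → length ts ≤ n × combine (λ _ → 1#) ts ≈ p
    × combine id ts ≈ x × combine (λ a → a * a) ts ≈ y

  abstract
    arc-empty : ∀ {p} → p ≈ 0# → Arc 0 p 0# 0#
    arc-empty p≈0 = [] , z≤n , sym p≈0 , refl , refl

    -- The weight must be p and the parameter x / p. The second moment is then forced; the caller
    -- corrects for it in the next pair.
    arc-point : ∀ {p} → p ≉ 0# → ∀ x → ∃ λ y → Arc 1 p x y
    arc-point {p} p≉0 x with inverse p p≉0
    ... | p⁻¹ , pp⁻¹≈1 = _ , (p , x * p⁻¹) ∷ [] , s≤s z≤n
      , solve 1 (λ p → p :* con (+ 1) :+ con (+ 0) := p) refl p
      , modulo pp⁻¹≈1 (solve 3 (λ p x i →
          p :* (x :* i) :+ con (+ 0) := x :+ x :* (p :* i :- con (+ 1))) refl p x p⁻¹)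
      , refl

    -- Opposite weights at the parameters 1 and 0 cancel in the moment of order 0. This suits the
    -- last pair of a chain, whose second moment enters no row.
    arc-difference : ∀ {p} → p ≈ 0# → ∀ x → ∃ λ y → Arc 2 p x y
    arc-difference {p} p≈0 x = _ , (x , 1#) ∷ (- x , 0#) ∷ [] , s≤s (s≤s z≤n)
      , trans (solve 1 (λ x → x :* con (+ 1) :+ ((:- x) :* con (+ 1) :+ con (+ 0)) := con (+ 0))
          refl x) (sym p≈0)
      , solve 1 (λ x → x :* con (+ 1) :+ ((:- x) :* con (+ 0) :+ con (+ 0)) := x) refl x
      , refl

    -- Weights k and -k at the parameters a and 0 give the moments 0, ka and ka²; solving for x and
    -- y yields a = y / x and k = x² / y.
    arc-chord : ∀ {p x y} → p ≈ 0# → x ≉ 0# → y ≉ 0# → Arc 2 p x y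
    arc-chord {p} {x} {y} p≈0 x≉0 y≉0 with inverse x x≉0 | inverse y y≉0
    ... | x⁻¹ , xx⁻¹≈1 | y⁻¹ , yy⁻¹≈1 = (k , a) ∷ (- k , 0#) ∷ [] , s≤s (s≤s z≤n)
      , trans (solve 1 (λ k → k :* con (+ 1) :+ ((:- k) :* con (+ 1) :+ con (+ 0)) := con (+ 0))
          refl k) (sym p≈0)
      , modulo xx⁻¹≈1 (modulo yy⁻¹≈1 (solve 4 (λ x y i j →
          (x :* x :* j) :* (y :* i) :+ ((:- (x :* x :* j)) :* con (+ 0) :+ con (+ 0))
            := (x :+ x :* (x :* i :- con (+ 1))) :+ (x :* (x :* i)) :* (y :* j :- con (+ 1)))
          refl x y x⁻¹ y⁻¹))
      , modulo xx⁻¹≈1 (modulo yy⁻¹≈1 (solve 4 (λ x y i j →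
          (x :* x :* j) :* ((y :* i) :* (y :* i))
              :+ ((:- (x :* x :* j)) :* (con (+ 0) :* con (+ 0)) :+ con (+ 0))
            := (y :+ (y :* (x :* i :+ con (+ 1))) :* (x :* i :- con (+ 1)))
              :+ (y :* (x :* i) :* (x :* i)) :* (y :* j :- con (+ 1)))
          refl x y x⁻¹ y⁻¹))
      where
      k a : Carrier
      k = x * x * y⁻¹
      a = y * x⁻¹

    module _ (4≤q : 4 ≤ q) where

      -- On the conic (1, a, a²), the secant through the target (1, u, w) and the
      -- point with parameter a meets the conic again at b = a + h / (u - a), where
      -- h = a² - 2ua + w; the target then is the point (1 - k) a + k b, k = (u - a)² / h.
      arc-secant : ∀ {p} → p ≉ 0# → ∀ x y → Arc 2 p x y
      arc-secant {p} p≉0 x y with inverse p p≉0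
      ... | p⁻¹ , pp⁻¹≈1 with nonroot 4≤q (x * p⁻¹) (y * p⁻¹)
      ... | a , g≉0 , h≉0 with inverse _ g≉0 | inverse _ h≉0
      ... | g⁻¹ , gg⁻¹≈1 | h⁻¹ , hh⁻¹≈1 =
          (p * (1# - k) , a) ∷ (p * k , b) ∷ [] , s≤s (s≤s z≤n)
        , solve 2 (λ p k → p :* (con (+ 1) :- k) :* con (+ 1) :+ (p :* k :* con (+ 1) :+ con (+ 0))
            := p) refl p k
        , trans (modulo gg⁻¹≈1 (modulo hh⁻¹≈1 (solve 6 (λ p a g h s t →
              p :* (con (+ 1) :- g :* g :* t) :* a :+ (p :* (g :* g :* t) :* (a :+ h :* s) :+ con (+ 0))
                := (p :* (a :+ g) :+ (p :* g) :* (g :* s :- con (+ 1)))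
                     :+ (p :* g :* (g :* s)) :* (h :* t :- con (+ 1)))
              refl p a g h g⁻¹ h⁻¹)))
            (modulo pp⁻¹≈1 (solve 4 (λ p x i a →
              p :* (a :+ (x :* i :- a)) := x :+ x :* (p :* i :- con (+ 1)))
              refl p x p⁻¹ a))
        , trans (modulo gg⁻¹≈1 (modulo hh⁻¹≈1 (solve 6 (λ p a g h s t →
              p :* (con (+ 1) :- g :* g :* t) :* (a :* a)
                  :+ (p :* (g :* g :* t) :* ((a :+ h :* s) :* (a :+ h :* s)) :+ con (+ 0))
                := (p :* (a :* a :+ (g :* a :+ g :* a) :+ h)
                     :+ (p :* g :* (a :+ (a :+ h :* s)) :+ p :* h) :* (g :* s :- con (+ 1)))
                     :+ (p :* g :* (g :* s) :* (a :+ (a :+ h :* s))) :* (h :* t :- con (+ 1)))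
              refl p a g h g⁻¹ h⁻¹)))
            (modulo pp⁻¹≈1 (solve 5 (λ p x y i a →
              p :* (a :* a :+ ((x :* i :- a) :* a :+ (x :* i :- a) :* a)
                  :+ (a :* a :- (x :* i :* a :+ x :* i :* a) :+ y :* i))
                := y :+ y :* (p :* i :- con (+ 1)))
              refl p x y p⁻¹ a))
        where
        g h k b : Carrier
        g = x * p⁻¹ - a
        h = a * a - (x * p⁻¹ * a + x * p⁻¹ * a) + y * p⁻¹
        k = g * g * h⁻¹
        b = a + h * g⁻¹

      -- At the parameters 0, 1, t the weights t - 1, -t, 1 cancel in the moments of order 0 and 1
      -- and leave t(t - 1), which is invertible and can be scaled to y.
      arc-triple : ∀ {p x} → p ≈ 0# → x ≈ 0# → ∀ y → Arc 3 p x y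
      arc-triple {p} {x} p≈0 x≈0 y with third-element 4≤q
      ... | t , t≉0 , t-1≉0 with inverse _ (xy≉0 t≉0 t-1≉0)
      ... | d , td≈1 = (k * (t - 1#) , 0#) ∷ (- (k * t) , 1#) ∷ (k , t) ∷ [] , s≤s (s≤s (s≤s z≤n))
        , trans (solve 2 (λ k t → k :* (t :- con (+ 1)) :* con (+ 1)
              :+ ((:- (k :* t)) :* con (+ 1) :+ (k :* con (+ 1) :+ con (+ 0)))
            := con (+ 0)) refl k t) (sym p≈0)
        , trans (solve 2 (λ k t → k :* (t :- con (+ 1)) :* con (+ 0)
              :+ ((:- (k :* t)) :* con (+ 1) :+ (k :* t :+ con (+ 0)))
            := con (+ 0)) refl k t) (sym x≈0)
        , modulo td≈1 (solve 3 (λ y t d → y :* d :* (t :- con (+ 1)) :* (con (+ 0) :* con (+ 0))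
              :+ ((:- (y :* d :* t)) :* (con (+ 1) :* con (+ 1)) :+ (y :* d :* (t :* t) :+ con (+ 0)))
            := y :+ y :* (t :* (t :- con (+ 1)) :* d :- con (+ 1))) refl y t d)
        where
        k : Carrier
        k = y * d

-- Linked pairs of rows, and their direct sums.

module Schemes {c ℓ q} (F : FiniteField c ℓ q) where
  open FiniteField F hiding (zero)
  open IntegerSolver commRing
  open FieldProperties F
  open Arcs F
  open SetoidReasoning setoid

  δ : ∀ {A : Set} → DecidableEquality A → A → A → Carrier
  δ _≟_ x y = if does (x ≟ y) then 1# else 0#

  module _ {A : Set} (_≟_ : DecidableEquality A) where

    δ-refl : ∀ x → δ _≟_ x x ≈ 1#
    δ-refl x rewrite dec-true (x ≟ x) ≡.refl = refl

    δ-≢ : ∀ {x y} → x ≢ y → δ _≟_ x y ≈ 0#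
    δ-≢ {x} {y} x≢y rewrite dec-false (x ≟ y) x≢y = refl

  -- Describes a matrix with two rows (leading, trailing) for each piece o ∈ O.
  -- The column (o , a) has entries 1 and a in the rows of o and the entry
  -- link o o′ * a² in the trailing row of o′; the column e ∈ E is the unit vector
  -- of the trailing row of apex e.
  record Scheme (R e : ℕ) : Set (Level.suc 0ℓ ⊔ c ⊔ ℓ) where
    infix 4 _≟ₒ_
    field
      O E            : Set
      pieces         : Fin R ↔ O
      extras         : Fin e ↔ E
      _≟ₒ_           : DecidableEquality O
      link           : O → O → Carrier
      link-irrefl    : ∀ o → link o o ≈ 0#
      final          : O
      link-final     : ∀ o → link final o ≈ 0#
      apex           : E → O
      apex-injective : ∀ {e e′} → apex e ≡ apex e′ → e ≡ e′

    Point : Set c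
    Point = O × Carrier ⊎ E

    leading : O → Point → Carrier
    leading o (inj₁ (o′ , a)) = δ _≟ₒ_ o′ o
    leading o (inj₂ e)        = 0#

    trailing : O → Point → Carrier
    trailing o (inj₁ (o′ , a)) = δ _≟ₒ_ o′ o * a + link o′ o * (a * a)
    trailing o (inj₂ e)        = δ _≟ₒ_ (apex e) o

    Reach : ℕ → (O → Carrier) → (O → Carrier) → Set (c ⊔ ℓ)
    Reach n p w = ∃ λ xs → length xs ≤ n
      × (∀ o → combine (leading o) xs ≈ p o) × (∀ o → combine (trailing o) xs ≈ w o)

    Saturating : Set (c ⊔ ℓ)
    Saturating = ∀ p w → Reach R p w

    reach-cong : ∀ {m n p p′ w w′} → m ≤ n → (∀ o → p o ≈ p′ o) → (∀ o → w o ≈ w′ o) →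
      Reach m p w → Reach n p′ w′
    reach-cong m≤n p≈p′ w≈w′ (xs , len , lead , trail) =
      xs , ℕ.≤-trans len m≤n , (λ o → trans (lead o) (p≈p′ o)) , (λ o → trans (trail o) (w≈w′ o))

    reach-+ : ∀ {m n p p′ w w′} → Reach m p w → Reach n p′ w′ →
      Reach (m ℕ.+ n) (λ o → p o + p′ o) (λ o → w o + w′ o)
    reach-+ (xs , len , lead , trail) (ys , len′ , lead′ , trail′) =
        xs ++ ys
      , ℕ.≤-trans (ℕ.≤-reflexive (List.length-++ xs)) (ℕ.+-mono-≤ len len′)
      , (λ o → trans (combine-++ (leading o) xs ys) (+-cong (lead o) (lead′ o)))
      , (λ o → trans (combine-++ (trailing o) xs ys) (+-cong (trail o) (trail′ o)))

    -- On the columns of `o` every row is a linear form in 1, a and a², so a combination of them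
    -- acts only through its three moments.
    reach-arc : ∀ o {n p x y} → Arc n p x y →
      Reach n (λ o′ → δ _≟ₒ_ o o′ * p) (λ o′ → δ _≟ₒ_ o o′ * x + link o o′ * y)
    reach-arc o {n} {p} {x} {y} (ts , len , m₀ , m₁ , m₂) =
        map (map₂ (λ a → inj₁ (o , a))) ts
      , ℕ.≤-trans (ℕ.≤-reflexive (List.length-map _ ts)) len
      , (λ o′ → begin
          combine (leading o′) (map (map₂ (λ a → inj₁ (o , a))) ts)
            ≡⟨ combine-map (leading o′) (λ a → inj₁ (o , a)) ts ⟩
          combine (λ _ → δ _≟ₒ_ o o′) ts
            ≈⟨ combine-cong (λ _ → *-identityʳ _) ts ⟨
          combine (λ _ → δ _≟ₒ_ o o′ * 1#) ts
            ≈⟨ combine-* (δ _≟ₒ_ o o′) _ ts ⟩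
          δ _≟ₒ_ o o′ * combine (λ _ → 1#) ts
            ≈⟨ *-congˡ m₀ ⟩
          δ _≟ₒ_ o o′ * p ∎)
      , (λ o′ → begin
          combine (trailing o′) (map (map₂ (λ a → inj₁ (o , a))) ts)
            ≡⟨ combine-map (trailing o′) (λ a → inj₁ (o , a)) ts ⟩
          combine (λ a → δ _≟ₒ_ o o′ * a + link o o′ * (a * a)) ts
            ≈⟨ combine-+ (λ a → δ _≟ₒ_ o o′ * a) (λ a → link o o′ * (a * a)) ts ⟩
          combine (λ a → δ _≟ₒ_ o o′ * a) ts + combine (λ a → link o o′ * (a * a)) ts
            ≈⟨ +-cong (combine-* (δ _≟ₒ_ o o′) id ts) (combine-* (link o o′) (λ a → a * a) ts) ⟩
          δ _≟ₒ_ o o′ * combine id ts + link o o′ * combine (λ a → a * a) ts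
            ≈⟨ +-cong (*-congˡ m₁) (*-congˡ m₂) ⟩
          δ _≟ₒ_ o o′ * x + link o o′ * y ∎)

    -- The zero target is written as a multiple of the unit vector at the apex, so that leaving the
    -- extra column out and using it have targets of the same shape.
    reach-nothing : ∀ e → Reach 0 (λ _ → 0#) (λ o → 0# * δ _≟ₒ_ (apex e) o)
    reach-nothing e = [] , z≤n , (λ _ → refl) , (λ _ → sym (zeroˡ _))

    reach-apex : ∀ e k → Reach 1 (λ _ → 0#) (λ o → k * δ _≟ₒ_ (apex e) o)
    reach-apex e k = (k , inj₂ e) ∷ [] , s≤s z≤n
      , (λ _ → trans (+-identityʳ _) (zeroʳ k)) , (λ _ → +-identityʳ _)

  infixr 6 _⊕_

  -- No link crosses between the summands, so the described matrix is block diagonal up to the order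
  -- of rows and columns.
  _⊕_ : ∀ {R e R′ e′} → Scheme R e → Scheme R′ e′ → Scheme (R ℕ.+ R′) (e ℕ.+ e′)
  S ⊕ T = record
    { O              = S.O ⊎ T.O
    ; E              = S.E ⊎ T.E
    ; pieces         = ↔-trans Fin.+↔⊎ (S.pieces ⊎-↔ T.pieces)
    ; extras         = ↔-trans Fin.+↔⊎ (S.extras ⊎-↔ T.extras)
    ; _≟ₒ_           = Sum.≡-dec S._≟ₒ_ T._≟ₒ_
    ; link           = link
    ; link-irrefl    = λ { (inj₁ o) → S.link-irrefl o ; (inj₂ o) → T.link-irrefl o }
    ; final          = inj₁ S.final
    ; link-final     = λ { (inj₁ o) → S.link-final o ; (inj₂ o) → refl }
    ; apex           = Sum.map S.apex T.apex
    ; apex-injective = λ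
        { {inj₁ _} {inj₁ _} eq → cong inj₁ (S.apex-injective (Sum.inj₁-injective eq))
        ; {inj₂ _} {inj₂ _} eq → cong inj₂ (T.apex-injective (Sum.inj₂-injective eq)) }
    }
    where
    module S = Scheme S
    module T = Scheme T
    link : S.O ⊎ T.O → S.O ⊎ T.O → Carrier
    link (inj₁ o) (inj₁ o′) = S.link o o′
    link (inj₂ o) (inj₂ o′) = T.link o o′
    link _        _         = 0#

  -- Each half of the target is reached within its own block, extended by zero to the other; the two
  -- budgets add up to that of the sum.
  ⊕-saturating : ∀ {R e R′ e′} (S : Scheme R e) (T : Scheme R′ e′) →
    Scheme.Saturating S → Scheme.Saturating T → Scheme.Saturating (S ⊕ T)
  ⊕-saturating S T satS satT p w = U.reach-cong ℕ.≤-refl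
    (λ { (inj₁ o) → +-identityʳ _ ; (inj₂ o) → +-identityˡ _ })
    (λ { (inj₁ o) → +-identityʳ _ ; (inj₂ o) → +-identityˡ _ })
    (U.reach-+ (left (satS (p ∘ inj₁) (w ∘ inj₁))) (right (satT (p ∘ inj₂) (w ∘ inj₂))))
    where
    module S = Scheme S
    module T = Scheme T
    module U = Scheme (S ⊕ T)

    extend₁ : (S.O → Carrier) → U.O → Carrier
    extend₁ f (inj₁ o) = f o
    extend₁ f (inj₂ o) = 0#

    extend₂ : (T.O → Carrier) → U.O → Carrier
    extend₂ f (inj₁ o) = 0#
    extend₂ f (inj₂ o) = f o

    ι₁ : S.Point → U.Point
    ι₁ (inj₁ (o , a)) = inj₁ (inj₁ o , a)
    ι₁ (inj₂ e)       = inj₂ (inj₁ e)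

    ι₂ : T.Point → U.Point
    ι₂ (inj₁ (o , a)) = inj₁ (inj₂ o , a)
    ι₂ (inj₂ e)       = inj₂ (inj₂ e)

    -- The form that a trailing entry outside its own block takes on unfolding: both the diagonal
    -- and the link coefficient are zero.
    0a+0b≈0 : ∀ a b → 0# * a + 0# * b ≈ 0#
    0a+0b≈0 a b = trans (+-cong (zeroˡ a) (zeroˡ b)) (+-identityʳ 0#)

    leading₁ : ∀ o x → U.leading o (ι₁ x) ≈ extend₁ (λ o → S.leading o x) o
    leading₁ (inj₁ o) (inj₁ _) = refl
    leading₁ (inj₁ o) (inj₂ _) = refl
    leading₁ (inj₂ o) (inj₁ _) = refl
    leading₁ (inj₂ o) (inj₂ _) = refl

    trailing₁ : ∀ o x → U.trailing o (ι₁ x) ≈ extend₁ (λ o → S.trailing o x) o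
    trailing₁ (inj₁ o) (inj₁ _) = refl
    trailing₁ (inj₁ o) (inj₂ _) = refl
    trailing₁ (inj₂ o) (inj₁ _) = 0a+0b≈0 _ _
    trailing₁ (inj₂ o) (inj₂ _) = refl

    leading₂ : ∀ o x → U.leading o (ι₂ x) ≈ extend₂ (λ o → T.leading o x) o
    leading₂ (inj₁ o) (inj₁ _) = refl
    leading₂ (inj₁ o) (inj₂ _) = refl
    leading₂ (inj₂ o) (inj₁ _) = refl
    leading₂ (inj₂ o) (inj₂ _) = refl

    trailing₂ : ∀ o x → U.trailing o (ι₂ x) ≈ extend₂ (λ o → T.trailing o x) o
    trailing₂ (inj₁ o) (inj₁ _) = 0a+0b≈0 _ _
    trailing₂ (inj₁ o) (inj₂ _) = refl
    trailing₂ (inj₂ o) (inj₁ _) = refl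
    trailing₂ (inj₂ o) (inj₂ _) = refl

    -- Stated for arbitrary row functions so that it serves the leading and the trailing rows alike.
    combine₁ : ∀ (f : U.O → U.Point → Carrier) (g : S.O → S.Point → Carrier) {h : S.O → Carrier} →
      (∀ o x → f o (ι₁ x) ≈ extend₁ (λ o → g o x) o) → ∀ xs →
      (∀ o → combine (g o) xs ≈ h o) →
      ∀ o → combine (f o) (map (map₂ ι₁) xs) ≈ extend₁ h o
    combine₁ f g f≈g xs eq o = trans (reflexive (combine-map (f o) ι₁ xs))
      (trans (combine-cong (f≈g o) xs) (lemma o))
      where
      lemma : ∀ o → combine (λ x → extend₁ (λ o → g o x) o) xs ≈ extend₁ _ o
      lemma (inj₁ o) = eq o
      lemma (inj₂ o) = combine-0 xs

    combine₂ : ∀ (f : U.O → U.Point → Carrier) (g : T.O → T.Point → Carrier) {h : T.O → Carrier} →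
      (∀ o x → f o (ι₂ x) ≈ extend₂ (λ o → g o x) o) → ∀ xs →
      (∀ o → combine (g o) xs ≈ h o) →
      ∀ o → combine (f o) (map (map₂ ι₂) xs) ≈ extend₂ h o
    combine₂ f g f≈g xs eq o = trans (reflexive (combine-map (f o) ι₂ xs))
      (trans (combine-cong (f≈g o) xs) (lemma o))
      where
      lemma : ∀ o → combine (λ x → extend₂ (λ o → g o x) o) xs ≈ extend₂ _ o
      lemma (inj₁ o) = combine-0 xs
      lemma (inj₂ o) = eq o

    left : ∀ {n p w} → S.Reach n p w → U.Reach n (extend₁ p) (extend₁ w)
    left (xs , len , lead , trail) = map (map₂ ι₁) xs
      , ℕ.≤-trans (ℕ.≤-reflexive (List.length-map _ xs)) len
      , combine₁ U.leading S.leading leading₁ xs lead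
      , combine₁ U.trailing S.trailing trailing₁ xs trail

    right : ∀ {n p w} → T.Reach n p w → U.Reach n (extend₂ p) (extend₂ w)
    right (xs , len , lead , trail) = map (map₂ ι₂) xs
      , ℕ.≤-trans (ℕ.≤-reflexive (List.length-map _ xs)) len
      , combine₂ U.leading T.leading leading₂ xs lead
      , combine₂ U.trailing T.trailing trailing₂ xs trail

-- Covering by chains of two and three pairs.

module Chains {c ℓ q} (F : FiniteField c ℓ q) (4≤q : 4 ≤ q) where
  open FiniteField F hiding (zero)
  open IntegerSolver commRing
  open FieldProperties F
  open Arcs F
  open Schemes F

  chain₂ : Scheme 2 1
  chain₂ = record
    { O              = Fin 2
    ; E              = ⊤
    ; pieces         = ↔-refl
    ; extras         = Fin.1↔⊤
    ; _≟ₒ_           = Fin._≟_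
    ; link           = λ { 0F 1F → 1# ; _ _ → 0# }
    ; link-irrefl    = λ { 0F → refl ; 1F → refl }
    ; final          = 1F
    ; link-final     = λ _ → refl
    ; apex           = λ _ → 0F
    ; apex-injective = λ _ → ≡.refl
    }

  chain₃ : Scheme 3 1
  chain₃ = record
    { O              = Fin 3
    ; E              = ⊤
    ; pieces         = ↔-refl
    ; extras         = Fin.1↔⊤
    ; _≟ₒ_           = Fin._≟_
    ; link           = λ { 0F 1F → 1# ; 1F 2F → 1# ; _ _ → 0# }
    ; link-irrefl    = λ { 0F → refl ; 1F → refl ; 2F → refl }
    ; final          = 2F
    ; link-final     = λ _ → refl
    ; apex           = λ _ → 0F
    ; apex-injective = λ _ → ≡.refl
    }

  y+[x-y]≈x : ∀ x y → y + (x - y) ≈ x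
  y+[x-y]≈x = solve 2 (λ x y → y :+ (x :- y) := x) refl

  module _ where
    open Scheme chain₂

    -- Trailing row 0 receives the weight `g` of the extra column and the first moment of pair 0;
    -- trailing row 1 receives the second moment of pair 0 through the link and the first moment of
    -- pair 1. The column count is concrete at each use, so its bound is settled by evaluation.
    assemble₂ : ∀ {k a b g x₀ y₀ x₁ y₁} (p w : O → Carrier) →
      Reach k (λ _ → 0#) (λ o → g * δ _≟ₒ_ 0F o) →
      Arc a (p 0F) x₀ y₀ → Arc b (p 1F) x₁ y₁ →
      g + x₀ ≈ w 0F → y₀ + x₁ ≈ w 1F →
      {True (k ℕ.+ (a ℕ.+ b) ≤? 2)} → Reach 2 p w
    assemble₂ {g = g} {x₀} {y₀} {x₁} {y₁} p w apex arc₀ arc₁ eq₀ eq₁ {small} =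
      reach-cong (toWitness small)
        (λ { 0F → solve 2 (λ a b →
               con (+ 0) :+ (con (+ 1) :* a :+ con (+ 0) :* b) := a) refl (p 0F) (p 1F)
           ; 1F → solve 2 (λ a b →
               con (+ 0) :+ (con (+ 0) :* a :+ con (+ 1) :* b) := b) refl (p 0F) (p 1F) })
        (λ { 0F → trans (solve 5 (λ g a b c d → g :* con (+ 1) :+
                    (con (+ 1) :* a :+ con (+ 0) :* b :+ (con (+ 0) :* c :+ con (+ 0) :* d))
                    := g :+ a) refl g x₀ y₀ x₁ y₁) eq₀
           ; 1F → trans (solve 5 (λ g a b c d → g :* con (+ 0) :+
                    (con (+ 0) :* a :+ con (+ 1) :* b :+ (con (+ 1) :* c :+ con (+ 0) :* d))
                    := b :+ c) refl g x₀ y₀ x₁ y₁) eq₁ })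
        (reach-+ apex (reach-+ (reach-arc 0F arc₀) (reach-arc 1F arc₁)))

    -- A nonzero leading coordinate claims a column of its own pair. If just one vanishes, the
    -- column it frees either completes a secant in pair 0 or is the extra column.
    chain₂-saturating : Saturating
    chain₂-saturating p w with p 0F ≟ 0# | p 1F ≟ 0#
    -- The second moment `y₀` of the point in pair 0 spills into the next trailing row and is
    -- subtracted from the target there.
    ... | no p₀≉0 | no p₁≉0 =
      let y₀ , arc₀ = arc-point p₀≉0 (w 0F)
          _  , arc₁ = arc-point p₁≉0 (w 1F - y₀)
      in assemble₂ p w (reach-nothing tt) arc₀ arc₁ (+-identityˡ _) (y+[x-y]≈x _ _)
    ... | no p₀≉0 | yes p₁≈0 =
      assemble₂ p w (reach-nothing tt) (arc-secant 4≤q p₀≉0 (w 0F) (w 1F)) (arc-empty p₁≈0)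
        (+-identityˡ _) (+-identityʳ _)
    ... | yes p₀≈0 | no p₁≉0 =
      assemble₂ p w (reach-apex tt (w 0F)) (arc-empty p₀≈0) (proj₂ (arc-point p₁≉0 (w 1F)))
        (+-identityʳ _) (+-identityˡ _)
    -- Both leading coordinates vanish. A chord of pair 0 settles two nonzero trailing coordinates
    -- at once; if one of them is zero, a difference in pair 1 or the extra column settles the
    -- other.
    ... | yes p₀≈0 | yes p₁≈0 with w 0F ≟ 0# | w 1F ≟ 0#
    ... | yes x₀≈0 | _ =
      assemble₂ p w (reach-nothing tt) (arc-empty p₀≈0) (proj₂ (arc-difference p₁≈0 (w 1F)))
        (trans (+-identityˡ _) (sym x₀≈0)) (+-identityˡ _)
    ... | no _ | yes x₁≈0 =
      assemble₂ p w (reach-apex tt (w 0F)) (arc-empty p₀≈0) (arc-empty p₁≈0)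
        (+-identityʳ _) (trans (+-identityˡ _) (sym x₁≈0))
    ... | no x₀≉0 | no x₁≉0 =
      assemble₂ p w (reach-nothing tt) (arc-chord p₀≈0 x₀≉0 x₁≉0) (arc-empty p₁≈0)
        (+-identityˡ _) (+-identityʳ _)

  module _ where
    open Scheme chain₃

    assemble₃ : ∀ {k a b c g x₀ y₀ x₁ y₁ x₂ y₂} (p w : O → Carrier) →
      Reach k (λ _ → 0#) (λ o → g * δ _≟ₒ_ 0F o) →
      Arc a (p 0F) x₀ y₀ → Arc b (p 1F) x₁ y₁ → Arc c (p 2F) x₂ y₂ →
      g + x₀ ≈ w 0F → y₀ + x₁ ≈ w 1F → y₁ + x₂ ≈ w 2F →
      {True (k ℕ.+ (a ℕ.+ (b ℕ.+ c)) ≤? 3)} → Reach 3 p w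
    assemble₃ {g = g} {x₀} {y₀} {x₁} {y₁} {x₂} {y₂} p w apex arc₀ arc₁ arc₂ eq₀ eq₁ eq₂ {small} =
      reach-cong (toWitness small)
        (λ { 0F → solve 3 (λ a b c → con (+ 0) :+
               (con (+ 1) :* a :+ (con (+ 0) :* b :+ con (+ 0) :* c)) := a)
               refl (p 0F) (p 1F) (p 2F)
           ; 1F → solve 3 (λ a b c → con (+ 0) :+
               (con (+ 0) :* a :+ (con (+ 1) :* b :+ con (+ 0) :* c)) := b)
               refl (p 0F) (p 1F) (p 2F)
           ; 2F → solve 3 (λ a b c → con (+ 0) :+
               (con (+ 0) :* a :+ (con (+ 0) :* b :+ con (+ 1) :* c)) := c)
               refl (p 0F) (p 1F) (p 2F) })
        (λ { 0F → trans (solve 7 (λ g a b c d e f → g :* con (+ 1) :+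
                    (con (+ 1) :* a :+ con (+ 0) :* b :+ (con (+ 0) :* c :+ con (+ 0) :* d
                      :+ (con (+ 0) :* e :+ con (+ 0) :* f)))
                    := g :+ a) refl g x₀ y₀ x₁ y₁ x₂ y₂) eq₀
           ; 1F → trans (solve 7 (λ g a b c d e f → g :* con (+ 0) :+
                    (con (+ 0) :* a :+ con (+ 1) :* b :+ (con (+ 1) :* c :+ con (+ 0) :* d
                      :+ (con (+ 0) :* e :+ con (+ 0) :* f)))
                    := b :+ c) refl g x₀ y₀ x₁ y₁ x₂ y₂) eq₁
           ; 2F → trans (solve 7 (λ g a b c d e f → g :* con (+ 0) :+
                    (con (+ 0) :* a :+ con (+ 0) :* b :+ (con (+ 0) :* c :+ con (+ 1) :* d
                      :+ (con (+ 1) :* e :+ con (+ 0) :* f)))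
                    := d :+ e) refl g x₀ y₀ x₁ y₁ x₂ y₂) eq₂ })
        (reach-+ apex (reach-+ (reach-arc 0F arc₀) (reach-+ (reach-arc 1F arc₁) (reach-arc 2F arc₂))))

    -- The budget is three columns, one of them claimed by each nonzero leading coordinate. With at
    -- least two of these nonzero, or only the middle one, what is left pays for a secant, the extra
    -- column or both; the remaining patterns also depend on the trailing coordinates.
    chain₃-saturating : Saturating
    chain₃-saturating p w with p 0F ≟ 0# | p 1F ≟ 0# | p 2F ≟ 0#
    ... | no p₀≉0 | no p₁≉0 | no p₂≉0 =
      let y₀ , arc₀ = arc-point p₀≉0 (w 0F)
          y₁ , arc₁ = arc-point p₁≉0 (w 1F - y₀)
          _  , arc₂ = arc-point p₂≉0 (w 2F - y₁)
      in assemble₃ p w (reach-nothing tt) arc₀ arc₁ arc₂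
           (+-identityˡ _) (y+[x-y]≈x _ _) (y+[x-y]≈x _ _)
    ... | no p₀≉0 | no p₁≉0 | yes p₂≈0 =
      let y₀ , arc₀ = arc-point p₀≉0 (w 0F)
      in assemble₃ p w (reach-nothing tt) arc₀
           (arc-secant 4≤q p₁≉0 (w 1F - y₀) (w 2F)) (arc-empty p₂≈0)
           (+-identityˡ _) (y+[x-y]≈x _ _) (+-identityʳ _)
    ... | no p₀≉0 | yes p₁≈0 | no p₂≉0 =
      assemble₃ p w (reach-nothing tt) (arc-secant 4≤q p₀≉0 (w 0F) (w 1F)) (arc-empty p₁≈0)
        (proj₂ (arc-point p₂≉0 (w 2F)))
        (+-identityˡ _) (+-identityʳ _) (+-identityˡ _)
    ... | yes p₀≈0 | no p₁≉0 | no p₂≉0 =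
      let y₁ , arc₁ = arc-point p₁≉0 (w 1F)
          _  , arc₂ = arc-point p₂≉0 (w 2F - y₁)
      in assemble₃ p w (reach-apex tt (w 0F)) (arc-empty p₀≈0) arc₁ arc₂
           (+-identityʳ _) (+-identityˡ _) (y+[x-y]≈x _ _)
    ... | yes p₀≈0 | no p₁≉0 | yes p₂≈0 =
      assemble₃ p w (reach-apex tt (w 0F)) (arc-empty p₀≈0)
        (arc-secant 4≤q p₁≉0 (w 1F) (w 2F)) (arc-empty p₂≈0)
        (+-identityʳ _) (+-identityˡ _) (+-identityʳ _)
    -- If `w 2F` vanishes, a secant in pair 0 settles the other two trailing rows. Otherwise a
    -- single point of pair 0 is fixed first, and whether its second moment already equals `w 1F`
    -- decides between a difference in pair 2 and a chord in pair 1.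
    chain₃-saturating p w | no p₀≉0 | yes p₁≈0 | yes p₂≈0
      with w 2F ≟ 0# | arc-point p₀≉0 (w 0F)
    ... | yes x₂≈0 | _ =
      assemble₃ p w (reach-nothing tt) (arc-secant 4≤q p₀≉0 (w 0F) (w 1F)) (arc-empty p₁≈0)
        (arc-empty p₂≈0)
        (+-identityˡ _) (+-identityʳ _) (trans (+-identityʳ _) (sym x₂≈0))
    ... | no x₂≉0 | y₀ , arc₀ with w 1F - y₀ ≟ 0#
    ... | yes u≈0 =
      assemble₃ p w (reach-nothing tt) arc₀ (arc-empty p₁≈0) (proj₂ (arc-difference p₂≈0 (w 2F)))
        (+-identityˡ _) (trans (+-identityʳ _) (sym (x-y≈0⇒x≈y u≈0))) (+-identityˡ _)
    ... | no u≉0 =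
      assemble₃ p w (reach-nothing tt) arc₀ (arc-chord p₁≈0 u≉0 x₂≉0) (arc-empty p₂≈0)
        (+-identityˡ _) (y+[x-y]≈x _ _) (+-identityʳ _)
    chain₃-saturating p w | yes p₀≈0 | yes p₁≈0 | no p₂≉0 with w 0F ≟ 0# | w 1F ≟ 0#
    ... | _ | yes x₁≈0 =
      assemble₃ p w (reach-apex tt (w 0F)) (arc-empty p₀≈0) (arc-empty p₁≈0)
        (proj₂ (arc-point p₂≉0 (w 2F)))
        (+-identityʳ _) (trans (+-identityˡ _) (sym x₁≈0)) (+-identityˡ _)
    ... | no x₀≉0 | no x₁≉0 =
      assemble₃ p w (reach-nothing tt) (arc-chord p₀≈0 x₀≉0 x₁≉0) (arc-empty p₁≈0)
        (proj₂ (arc-point p₂≉0 (w 2F)))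
        (+-identityˡ _) (+-identityʳ _) (+-identityˡ _)
    -- The second moment of the chord may be any nonzero value, since the point of pair 2
    -- compensates for it; `w 1F` is one known to be nonzero.
    ... | yes x₀≈0 | no x₁≉0 =
      assemble₃ p w (reach-nothing tt) (arc-empty p₀≈0) (arc-chord p₁≈0 x₁≉0 x₁≉0)
        (proj₂ (arc-point p₂≉0 (w 2F - w 1F)))
        (trans (+-identityˡ _) (sym x₀≈0)) (+-identityˡ _) (y+[x-y]≈x _ _)
    chain₃-saturating p w | yes p₀≈0 | yes p₁≈0 | yes p₂≈0
      with w 0F ≟ 0# | w 1F ≟ 0# | w 2F ≟ 0#
    ... | _ | yes x₁≈0 | _ =
      assemble₃ p w (reach-apex tt (w 0F)) (arc-empty p₀≈0) (arc-empty p₁≈0)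
        (proj₂ (arc-difference p₂≈0 (w 2F)))
        (+-identityʳ _) (trans (+-identityˡ _) (sym x₁≈0)) (+-identityˡ _)
    ... | _ | no x₁≉0 | no x₂≉0 =
      assemble₃ p w (reach-apex tt (w 0F)) (arc-empty p₀≈0) (arc-chord p₁≈0 x₁≉0 x₂≉0)
        (arc-empty p₂≈0)
        (+-identityʳ _) (+-identityˡ _) (+-identityʳ _)
    ... | no x₀≉0 | no x₁≉0 | yes x₂≈0 =
      assemble₃ p w (reach-nothing tt) (arc-chord p₀≈0 x₀≉0 x₁≉0) (arc-empty p₁≈0)
        (arc-empty p₂≈0)
        (+-identityˡ _) (+-identityʳ _) (trans (+-identityʳ _) (sym x₂≈0))
    -- The target is a multiple of the point at infinity of pair 1, which is not a column. Three
    -- points of pair 0 reach it through the link.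
    ... | yes x₀≈0 | no x₁≉0 | yes x₂≈0 =
      assemble₃ p w (reach-nothing tt) (arc-triple 4≤q p₀≈0 x₀≈0 (w 1F)) (arc-empty p₁≈0)
        (arc-empty p₂≈0)
        (+-identityˡ _) (+-identityʳ _) (trans (+-identityʳ _) (sym x₂≈0))

  ceil3-3+ : ∀ R → ceil3 (3 ℕ.+ R) ≡ 1 ℕ.+ ceil3 R
  ceil3-3+ R = ℕ.m/n≡1+[m∸n]/n {3 ℕ.+ R ℕ.+ 2} {3} (ℕ.m≤m+n 3 _)

  -- Chains of length three are split off while at least two pairs remain, which ends at 2, 3 or 4.
  -- Since 4 = 2 + 2 takes two chains, the number of chains, hence of extra columns, is ⌈R/3⌉
  -- throughout.
  saturating-scheme : ∀ {R} → 2 ≤ R → Σ (Scheme R (ceil3 R)) Scheme.Saturating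
  saturating-scheme {0} ()
  saturating-scheme {1} (s≤s ())
  saturating-scheme {2} _ = chain₂ , chain₂-saturating
  saturating-scheme {3} _ = chain₃ , chain₃-saturating
  saturating-scheme {4} _ =
    chain₂ ⊕ chain₂ , ⊕-saturating chain₂ chain₂ chain₂-saturating chain₂-saturating
  saturating-scheme {suc (suc (suc R@(suc (suc _))))} _ =
    let S , sat = saturating-scheme {R} (s≤s (s≤s z≤n))
    in ≡.subst (λ e → Σ (Scheme (3 ℕ.+ R) e) Scheme.Saturating) (≡.sym (ceil3-3+ R))
         (chain₃ ⊕ S , ⊕-saturating chain₃ S chain₃-saturating sat)

-- Cardinalities of finite subsets.

∣p∪q∣≤∣p∣+∣q∣ : ∀ {n} (p q : Subset n) → ∣ p ∪ q ∣ ≤ ∣ p ∣ ℕ.+ ∣ q ∣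
∣p∪q∣≤∣p∣+∣q∣ Vec.[] Vec.[] = z≤n
∣p∪q∣≤∣p∣+∣q∣ (outside Vec.∷ p) (outside Vec.∷ q) = ∣p∪q∣≤∣p∣+∣q∣ p q
∣p∪q∣≤∣p∣+∣q∣ (outside Vec.∷ p) (inside Vec.∷ q) =
  ℕ.≤-trans (s≤s (∣p∪q∣≤∣p∣+∣q∣ p q)) (ℕ.≤-reflexive (≡.sym (ℕ.+-suc ∣ p ∣ ∣ q ∣)))
∣p∪q∣≤∣p∣+∣q∣ (inside Vec.∷ p) (outside Vec.∷ q) = s≤s (∣p∪q∣≤∣p∣+∣q∣ p q)
∣p∪q∣≤∣p∣+∣q∣ (inside Vec.∷ p) (inside Vec.∷ q) =
  s≤s (ℕ.≤-trans (∣p∪q∣≤∣p∣+∣q∣ p q) (ℕ.+-monoʳ-≤ ∣ p ∣ (ℕ.n≤1+n ∣ q ∣)))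

-- Deleting the head from `p` lowers the cardinality, while distinctness keeps the tail inside.
-- Lower bounds on weights come from listing distinct positions.
length≤∣p∣ : ∀ {n} {xs : List (Fin n)} {p : Subset n} →
  Unique xs → All (_∈ p) xs → length xs ≤ ∣ p ∣
length≤∣p∣ []              []            = z≤n
length≤∣p∣ (x≢xs ∷ unique) (x∈p ∷ xs⊆p) = ℕ.≤-trans
  (s≤s (length≤∣p∣ unique (All.zipWith
    (λ { (x≢y , y∈p) → Subset.x∈p∧x≢y⇒x∈p-y y∈p (x≢y ∘ ≡.sym) }) (x≢xs , xs⊆p))))
  (Subset.x∈p⇒∣p-x∣<∣p∣ x∈p)

-- Sparse vectors and criteria for rank, minimum distance, partitions and covering radius.

module Matrices {c ℓ q} (F : FiniteField c ℓ q) where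
  open FiniteField F hiding (zero)
  open IntegerSolver commRing
  open FieldProperties F
  open CodeDefs F
  open Algebra.Properties.Semiring.Sum semiring
    using (sum; sum-cong-≋; sum-replicate-zero; ∑-distrib-+; *-distribˡ-sum; ∑-comm)
  open SetoidReasoning setoid

  ∑≡sum : ∀ {n} (f : Fin n → Carrier) → ∑ f ≡ sum f
  ∑≡sum {zero}  f = ≡.refl
  ∑≡sum {suc n} f = cong (_+_ (f zero)) (∑≡sum (f ∘ suc))

  ∑≈sum : ∀ {n} (f : Fin n → Carrier) → ∑ f ≈ sum f
  ∑≈sum f = reflexive (∑≡sum f)

  ∑-cong : ∀ {n} {f g : Fin n → Carrier} → (∀ i → f i ≈ g i) → ∑ f ≈ ∑ g
  ∑-cong {f = f} {g} f≈g = trans (∑≈sum f) (trans (sum-cong-≋ f≈g) (sym (∑≈sum g)))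

  ∑-zero : ∀ {n} {f : Fin n → Carrier} → (∀ i → f i ≈ 0#) → ∑ f ≈ 0#
  ∑-zero {n} {f} f≈0 =
    trans (∑≈sum f) (trans (sum-cong-≋ {x = f} {λ _ → 0#} f≈0) (sum-replicate-zero n))

  ∑-+ : ∀ {n} (f g : Fin n → Carrier) → ∑ (λ i → f i + g i) ≈ ∑ f + ∑ g
  ∑-+ f g = trans (∑≈sum (λ i → f i + g i))
    (trans (∑-distrib-+ f g) (+-cong (sym (∑≈sum f)) (sym (∑≈sum g))))

  *-∑ : ∀ {n} k (f : Fin n → Carrier) → k * ∑ f ≈ ∑ (λ i → k * f i)
  *-∑ k f = trans (*-congˡ (∑≈sum f)) (trans (*-distribˡ-sum k f) (sym (∑≈sum (λ i → k * f i))))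

  ∑-swap : ∀ {m n} (f : Fin m → Fin n → Carrier) →
    ∑ (λ i → ∑ (λ j → f i j)) ≈ ∑ (λ j → ∑ (λ i → f i j))
  ∑-swap f = begin
    ∑ (λ i → ∑ (f i))             ≈⟨ ∑-cong (λ i → ∑≈sum (f i)) ⟩
    ∑ (λ i → sum (f i))           ≈⟨ ∑≈sum (λ i → sum (f i)) ⟩
    sum (λ i → sum (f i))         ≈⟨ ∑-comm f ⟩
    sum (λ j → sum (λ i → f i j)) ≈⟨ ∑≈sum (λ j → sum (λ i → f i j)) ⟨
    ∑ (λ j → sum (λ i → f i j))   ≈⟨ ∑-cong (λ j → ∑≈sum (λ i → f i j)) ⟨
    ∑ (λ j → ∑ (λ i → f i j))     ∎

  single : ∀ {n} → Fin n → Carrier → Vector n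
  single j k l = if does (j Fin.≟ l) then k else 0#

  single-≡ : ∀ {n} (j : Fin n) k → single j k j ≡ k
  single-≡ j k rewrite dec-true (j Fin.≟ j) ≡.refl = ≡.refl

  single-≢ : ∀ {n} {j l : Fin n} k → j ≢ l → single j k l ≡ 0#
  single-≢ {j = j} {l} k j≢l rewrite dec-false (j Fin.≟ l) j≢l = ≡.refl

  ∑-single : ∀ {n} (f : Fin n → Carrier) j k → ∑ (λ l → f l * single j k l) ≈ f j * k
  ∑-single f zero    k = trans (+-congˡ (∑-zero (λ l → zeroʳ (f (suc l))))) (+-identityʳ _)
  ∑-single f (suc j) k =
    trans (+-cong (zeroʳ _) (∑-single (f ∘ suc) j k)) (+-identityˡ _)

  module _ {n : ℕ} where

    -- Coefficients of a repeated index are added, so a list with repetitions still describes one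
    -- coefficient vector.
    vec : List (Carrier × Fin n) → Vector n
    vec []             l = 0#
    vec ((k , j) ∷ xs) l = single j k l + vec xs l

    indices : List (Carrier × Fin n) → Subset n
    indices []             = ⊥
    indices ((_ , j) ∷ xs) = ⁅ j ⁆ ∪ indices xs

    ∣indices∣≤length : ∀ xs → ∣ indices xs ∣ ≤ length xs
    ∣indices∣≤length []             = ℕ.≤-reflexive (Subset.∣⊥∣≡0 n)
    ∣indices∣≤length ((_ , j) ∷ xs) = ℕ.≤-trans (∣p∪q∣≤∣p∣+∣q∣ ⁅ j ⁆ (indices xs))
      (ℕ.+-mono-≤ (ℕ.≤-reflexive (Subset.∣⁅x⁆∣≡1 j)) (∣indices∣≤length xs))

    vec-supported : ∀ xs → SupportedOn (vec xs) (indices xs)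
    vec-supported []             l l∉ = refl
    vec-supported ((k , j) ∷ xs) l l∉ = trans
      (+-cong (reflexive (single-≢ {j = j} {l} k (λ { ≡.refl →
          l∉ (Subset.p⊆p∪q (indices xs) (Subset.x∈⁅x⁆ l)) })))
        (vec-supported xs l (l∉ ∘ Subset.q⊆p∪q ⁅ j ⁆ (indices xs))))
      (+-identityʳ 0#)

    -- Decidability over finitely many positions turns the negated statement into a witness.
    nonzero-outside : ∀ {p} {P : Fin n → Set p} (P? : ∀ j → Dec (P j)) (x : Vector n) →
      ¬ (∀ j → ¬ P j → x j ≈ 0#) → ∃ λ j → ¬ P j × x j ≉ 0#
    nonzero-outside P? x ¬supp
      with Fin.¬∀⟶∃¬ n _ (λ j → P? j ⊎-dec (x j ≟ 0#))
        (λ all → ¬supp (λ j ¬Pj → Sum.fromInj₂ (λ Pj → contradiction Pj ¬Pj) (all j)))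
    ... | j , ¬both = j , ¬both ∘ inj₁ , ¬both ∘ inj₂

    supported-∈ : ∀ (x : Vector n) S → SupportedOn x S → ∀ {j} → x j ≉ 0# → j ∈ S
    supported-∈ x S supp {j} xj≉0 =
      decidable-stable (j Subset.∈? S) (λ j∉S → xj≉0 (supp j j∉S))

    support : Vector n → Subset n
    support x = Vec.tabulate (λ j → not (does (x j ≟ 0#)))

    ∈-support⁺ : ∀ x {j} → x j ≉ 0# → j ∈ support x
    ∈-support⁺ x {j} xj≉0 = Vec.lookup⇒[]= j (support x)
      (≡.trans (Vec.lookup∘tabulate _ j) (cong not (dec-false (x j ≟ 0#) xj≉0)))

    ∈-support⁻ : ∀ x {j} → j ∈ support x → x j ≉ 0#
    ∈-support⁻ x {j} j∈ xj≈0
      with ≡.trans (≡.sym (cong not (dec-true (x j ≟ 0#) xj≈0)))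
             (≡.trans (≡.sym (Vec.lookup∘tabulate _ j)) (Vec.[]=⇒lookup j∈))
    ... | ()

    support-supports : ∀ x → SupportedOn x (support x)
    support-supports x j j∉ = decidable-stable (x j ≟ 0#) (j∉ ∘ ∈-support⁺ x)

    ∣support∣≤ : ∀ (x : Vector n) S → SupportedOn x S → ∣ support x ∣ ≤ ∣ S ∣
    ∣support∣≤ x S supp =
      Subset.p⊆q⇒∣p∣≤∣q∣ (λ j∈ → supported-∈ x S supp (∈-support⁻ x j∈))

    Nonzero⇒1≤∣support∣ : ∀ x → Nonzero x → 1 ≤ ∣ support x ∣
    Nonzero⇒1≤∣support∣ x x≉0 with Fin.¬∀⟶∃¬ n _ (λ j → x j ≟ 0#) x≉0
    ... | j , xj≉0 = length≤∣p∣ {xs = j ∷ []} ([] ∷ []) (∈-support⁺ x xj≉0 ∷ [])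

    discrete : Partition n
    discrete = record { m = n ; part = id ; nonempty = λ t → t , ≡.refl }

  module _ {r n : ℕ} (H : Matrix r n) where

    ·-cong : ∀ {x y} → x ≈ᵥ y → (H · x) ≈ᵥ (H · y)
    ·-cong x≈y i = ∑-cong (λ j → *-congˡ (x≈y j))

    ·-zero : ∀ {x} → x ≈ᵥ 0ᵥ → (H · x) ≈ᵥ 0ᵥ
    ·-zero x≈0 i = ∑-zero (λ j → trans (*-congˡ (x≈0 j)) (zeroʳ _))

    ·-+ : ∀ x y i → (H · (λ l → x l + y l)) i ≈ (H · x) i + (H · y) i
    ·-+ x y i = trans (∑-cong (λ j → distribˡ (H i j) (x j) (y j))) (∑-+ (λ j → H i j * x j) (λ j → H i j * y j))

    ·-single : ∀ j k i → (H · single j k) i ≈ k * H i j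
    ·-single j k i = trans (∑-single (H i) j k) (*-comm _ _)

    ·-vec : ∀ xs i → (H · vec xs) i ≈ combine (H i) xs
    ·-vec []             i = ·-zero (λ _ → refl) i
    ·-vec ((k , j) ∷ xs) i = trans (·-+ _ _ i) (+-cong (·-single j k i) (·-vec xs i))

    combine⇒CombAtMost : ∀ {k v} xs → length xs ≤ k → (∀ i → combine (H i) xs ≈ v i) →
      CombAtMost H k v
    combine⇒CombAtMost xs len eq = indices xs , ℕ.≤-trans (∣indices∣≤length xs) len
      , vec xs , vec-supported xs , λ i → trans (·-vec xs i) (eq i)

    -- If Hx is the i-th unit vector, then aᵢ = a(Hx) = (aH)x = 0.
    surjective⇒FullRowRank : (∀ v → ∃ λ x → (H · x) ≈ᵥ v) → FullRowRank H
    surjective⇒FullRowRank surj a aH≈0 i with surj (single i 1#)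
    ... | x , Hx≈eᵢ = begin
      a i                                            ≈⟨ *-identityʳ _ ⟨
      a i * 1#                                       ≈⟨ ∑-single a i 1# ⟨
      ∑ (λ k → a k * single i 1# k)                  ≈⟨ ∑-cong (λ k → *-congˡ (Hx≈eᵢ k)) ⟨
      ∑ (λ k → a k * ∑ (λ j → H k j * x j))          ≈⟨ ∑-cong (λ k → *-∑ (a k) (λ j → H k j * x j)) ⟩
      ∑ (λ k → ∑ (λ j → a k * (H k j * x j)))        ≈⟨ ∑-swap (λ k j → a k * (H k j * x j)) ⟩
      ∑ (λ j → ∑ (λ k → a k * (H k j * x j)))        ≈⟨ ∑-cong (λ j → ∑-cong (λ k →
                                                          solve 3 (λ a h x → a :* (h :* x) := x :* (a :* h))
                                                            refl (a k) (H k j) (x j))) ⟩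
      ∑ (λ j → ∑ (λ k → x j * (a k * H k j)))        ≈⟨ ∑-cong (λ j → *-∑ (x j) (λ k → a k * H k j)) ⟨
      ∑ (λ j → x j * ∑ (λ k → a k * H k j))          ≈⟨ ∑-zero (λ j →
                                                          trans (*-congˡ (aH≈0 j)) (zeroʳ _)) ⟩
      0#                                             ∎

    -- A codeword living on one or two positions would be a dependence of one or two columns, so a
    -- search outside the positions found so far succeeds twice. The second hypothesis concludes
    -- about the first coefficient, which is the one known to be nonzero at `j₁`.
    distance≥3 :
      (∀ j k → (∀ i → k * H i j ≈ 0#) → k ≈ 0#) →
      (∀ {j j′} k k′ → j ≢ j′ → (∀ i → k * H i j + k′ * H i j′ ≈ 0#) → k ≈ 0#) →
      ∀ x → Codeword H x → Nonzero x → ∀ d → WeightAtMost d x → 3 ≤ d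
    distance≥3 nonzero independent x Hx≈0 x≉0 d (S , ∣S∣≤d , supp)
      with Fin.¬∀⟶∃¬ n _ (λ j → x j ≟ 0#) x≉0
    ... | j₁ , x₁≉0
      with nonzero-outside (j₁ Fin.≟_) x (λ x≈0 → x₁≉0 (nonzero j₁ (x j₁) (λ i → begin
        x j₁ * H i j₁              ≈⟨ ·-single j₁ (x j₁) i ⟨
        (H · single j₁ (x j₁)) i   ≈⟨ ·-cong (on-one x≈0) i ⟨
        (H · x) i                  ≈⟨ Hx≈0 i ⟩
        0#                         ∎)))
      where
      on-one : (∀ j → j₁ ≢ j → x j ≈ 0#) → x ≈ᵥ single j₁ (x j₁)
      on-one x≈0 j with j₁ Fin.≟ j
      ... | yes ≡.refl = refl
      ... | no j₁≢j    = x≈0 j j₁≢j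
    ... | j₂ , j₁≢j₂ , x₂≉0
      with nonzero-outside (λ j → (j₁ Fin.≟ j) ⊎-dec (j₂ Fin.≟ j)) x
        (λ x≈0 → x₁≉0 (independent (x j₁) (x j₂) j₁≢j₂ (λ i → begin
        x j₁ * H i j₁ + x j₂ * H i j₂
          ≈⟨ +-cong (·-single j₁ (x j₁) i) (·-single j₂ (x j₂) i) ⟨
        (H · single j₁ (x j₁)) i + (H · single j₂ (x j₂)) i
          ≈⟨ ·-+ _ _ i ⟨
        (H · (λ l → single j₁ (x j₁) l + single j₂ (x j₂) l)) i
          ≈⟨ ·-cong (on-two x≈0) i ⟨
        (H · x) i
          ≈⟨ Hx≈0 i ⟩
        0# ∎)))
      where
      on-two : (∀ j → ¬ (j₁ ≡ j ⊎ j₂ ≡ j) → x j ≈ 0#) →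
        x ≈ᵥ (λ l → single j₁ (x j₁) l + single j₂ (x j₂) l)
      on-two x≈0 j with j₁ Fin.≟ j | j₂ Fin.≟ j
      ... | yes ≡.refl | yes ≡.refl = contradiction ≡.refl j₁≢j₂
      ... | yes ≡.refl | no _       = sym (+-identityʳ _)
      ... | no _       | yes ≡.refl = sym (+-identityˡ _)
      ... | no j₁≢j    | no j₂≢j    = trans
        (x≈0 j λ { (inj₁ eq) → j₁≢j eq ; (inj₂ eq) → j₂≢j eq }) (sym (+-identityʳ 0#))
    ... | j₃ , j₁₂≢j₃ , x₃≉0 = ℕ.≤-trans
      (length≤∣p∣ {xs = j₁ ∷ j₂ ∷ j₃ ∷ []} {p = S}
        ((j₁≢j₂ ∷ j₁₂≢j₃ ∘ inj₁ ∷ []) ∷ (j₁₂≢j₃ ∘ inj₂ ∷ []) ∷ [] ∷ [])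
        (supported-∈ x S supp x₁≉0 ∷ supported-∈ x S supp x₂≉0 ∷ supported-∈ x S supp x₃≉0 ∷ []))
      ∣S∣≤d

    -- A nonzero codeword of weight at most R represents the zero column by a
    -- combination with at least one term.
    discrete-partition : ∀ {R x} → (∀ v → CombAtMost H R v) →
      Codeword H x → Nonzero x → WeightAtMost R x → IsRlPartition H R 1 discrete
    discrete-partition {R} {x} covers Hx≈0 x≉0 (S , ∣S∣≤R , supp) v with covers v
    ... | T , ∣T∣≤R , y , suppʸ , Hy≈v with Fin.all? (λ j → y j ≟ 0#)
    ... | no y≉0 = support y , Nonzero⇒1≤∣support∣ y y≉0
      , ℕ.≤-trans (∣support∣≤ y T suppʸ) ∣T∣≤R , (λ _ _ _ _ → id)
      , y , (λ _ → ∈-support⁻ y) , support-supports y , Hy≈v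
    ... | yes y≈0 = support x , Nonzero⇒1≤∣support∣ x x≉0
      , ℕ.≤-trans (∣support∣≤ x S supp) ∣S∣≤R , (λ _ _ _ _ → id)
      , x , (λ _ → ∈-support⁻ x) , support-supports x
      , λ i → trans (Hx≈0 i) (trans (sym (·-zero y≈0 i)) (Hy≈v i))

    -- No column meets two of the rows ρ 0, …, ρ (R - 1), so reaching a vector that
    -- is 1 in all of them takes R columns.
    covering-bound : ∀ {R} (ρ : Fin R → Fin r) →
      (∀ {i i′ j} → H (ρ i) j ≉ 0# → H (ρ i′) j ≉ 0# → i ≡ i′) →
      ∀ R′ → (∀ v → CombAtMost H R′ v) → R ≤ R′
    covering-bound {R} ρ unshared R′ covers with covers (λ _ → 1#)
    ... | S , ∣S∣≤R′ , a , supp , Ha≈1 = ℕ.≤-trans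
      (ℕ.≤-reflexive (≡.sym (List.length-tabulate column)))
      (ℕ.≤-trans (length≤∣p∣ {p = S} (Unique.tabulate⁺ column-injective)
        (All.tabulate⁺ (λ i → supported-∈ a S supp (proj₂ (term≉0 i))))) ∣S∣≤R′)
      where
      term : ∀ i → ∃ λ j → H (ρ i) j * a j ≉ 0#
      term i = Fin.¬∀⟶∃¬ n _ (λ j → H (ρ i) j * a j ≟ 0#)
        (λ all≈0 → 1≉0 (trans (sym (Ha≈1 (ρ i))) (∑-zero all≈0)))

      column : Fin R → Fin n
      column i = proj₁ (term i)

      term≉0 : ∀ i → H (ρ i) (column i) ≉ 0# × a (column i) ≉ 0#
      term≉0 i = (λ h≈0 → proj₂ (term i) (trans (*-congʳ h≈0) (zeroˡ _)))
               , (λ a≈0 → proj₂ (term i) (trans (*-congˡ a≈0) (zeroʳ _)))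

      column-injective : ∀ {i i′} → column i ≡ column i′ → i ≡ i′
      column-injective {i} {i′} eq = unshared (proj₁ (term≉0 i))
        (≡.subst (λ j → H (ρ i′) j ≉ 0#) (≡.sym eq) (proj₁ (term≉0 i′)))

-- The parity-check matrix of a scheme and its parameters.

↔-to-injective : ∀ {a b} {A : Set a} {B : Set b} (f : A ↔ B) {x y} →
  Inverse.to f x ≡ Inverse.to f y → x ≡ y
↔-to-injective f {x} {y} eq = ≡.trans (≡.sym (Inverse.strictlyInverseʳ f x))
  (≡.trans (cong (Inverse.from f) eq) (Inverse.strictlyInverseʳ f y))

module SchemeCode {c ℓ q} (F : FiniteField c ℓ q) {R e : ℕ} (S : Schemes.Scheme F R e) where
  open FiniteField F hiding (zero)
  open IntegerSolver commRing
  open FieldProperties F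
  open CodeDefs F
  open Matrices F
  open Schemes F using (δ; δ-refl; δ-≢)
  open Schemes.Scheme S
  open SetoidReasoning setoid

  rows : Fin (2 ℕ.* R) ↔ (Fin 2 × O)
  rows = ↔-trans Fin.*↔× (↔-refl ×-↔ pieces)

  columns : Fin (R ℕ.* q ℕ.+ e) ↔ (O × Fin q ⊎ E)
  columns = ↔-trans Fin.+↔⊎ (↔-trans Fin.*↔× (pieces ×-↔ ↔-refl) ⊎-↔ extras)

  module rows = Inverse rows
  module columns = Inverse columns

  point : O × Fin q ⊎ E → Point
  point (inj₁ (o , i)) = inj₁ (o , element i)
  point (inj₂ e)       = inj₂ e

  entry : Fin 2 × O → Point → Carrier
  entry (0F , o) = leading o
  entry (1F , o) = trailing o

  H : Matrix (2 ℕ.* R) (R ℕ.* q ℕ.+ e)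
  H i j = entry (rows.to i) (point (columns.to j))

  position : Point → Fin (R ℕ.* q ℕ.+ e)
  position (inj₁ (o , a)) = columns.from (inj₁ (o , index a))
  position (inj₂ e)       = columns.from (inj₂ e)

  -- Passing through the enumeration replaces a by `element (index a)`, which agrees with a only up
  -- to the equality of the field.
  H-position : ∀ i x → H i (position x) ≈ entry (rows.to i) x
  H-position i x = trans (reflexive (cong (entry (rows.to i) ∘ point) (to-position x)))
    (entry-label (rows.to i) x)
    where
    label : Point → O × Fin q ⊎ E
    label (inj₁ (o , a)) = inj₁ (o , index a)
    label (inj₂ e)       = inj₂ e

    to-position : ∀ x → columns.to (position x) ≡ label x
    to-position (inj₁ _) = columns.strictlyInverseˡ _
    to-position (inj₂ _) = columns.strictlyInverseˡ _

    entry-label : ∀ r x → entry r (point (label x)) ≈ entry r x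
    entry-label (0F , o) (inj₁ (_ , a)) = refl
    entry-label (1F , o) (inj₁ (_ , a)) = +-cong (*-congˡ (element-index a))
      (*-congˡ (*-cong (element-index a) (element-index a)))
    entry-label (0F , o) (inj₂ _) = refl
    entry-label (1F , o) (inj₂ _) = refl

  H-covers : ∀ {n} v xs → length xs ≤ n →
    (∀ r → combine (entry r) xs ≈ v (rows.from r)) → CombAtMost H n v
  H-covers v xs len eq = combine⇒CombAtMost H (map (map₂ position) xs)
    (ℕ.≤-trans (ℕ.≤-reflexive (List.length-map _ xs)) len)
    (λ i → begin
      combine (H i) (map (map₂ position) xs)   ≡⟨ combine-map (H i) position xs ⟩
      combine (H i ∘ position) xs              ≈⟨ combine-cong (H-position i) xs ⟩
      combine (entry (rows.to i)) xs           ≈⟨ eq (rows.to i) ⟩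
      v (rows.from (rows.to i))                ≡⟨ cong v (rows.strictlyInverseʳ i) ⟩
      v i                                      ∎)

  isolate : ∀ {k l x y} → x ≈ 1# → y ≈ 0# → k * x + l * y ≈ 0# → k ≈ 0#
  isolate {k} {l} x≈1 y≈0 eq = begin
    k                  ≈⟨ solve 2 (λ k l → k := k :* con (+ 1) :+ l :* con (+ 0)) refl k l ⟩
    k * 1# + l * 0#    ≈⟨ +-cong (*-congˡ x≈1) (*-congˡ y≈0) ⟨
    k * _ + l * _      ≈⟨ eq ⟩
    0#                 ∎

  entry-nonzero : ∀ x k → (∀ r → k * entry r x ≈ 0#) → k ≈ 0#
  entry-nonzero (inj₁ (o , a)) k eq = isolate {l = 0#} (δ-refl _≟ₒ_ o) refl
    (trans (+-cong (eq (0F , o)) (zeroˡ 0#)) (+-identityʳ 0#))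
  entry-nonzero (inj₂ e) k eq = isolate {l = 0#} (δ-refl _≟ₒ_ (apex e)) refl
    (trans (+-cong (eq (1F , apex e)) (zeroˡ 0#)) (+-identityʳ 0#))

  -- As no pair is linked to itself, the quadratic term is absent here, and the own trailing row
  -- tells the columns of a pair apart.
  trailing-own : ∀ o a → trailing o (inj₁ (o , a)) ≈ a
  trailing-own o a = begin
    δ _≟ₒ_ o o * a + link o o * (a * a)   ≈⟨ +-cong (*-congʳ (δ-refl _≟ₒ_ o)) (*-congʳ (link-irrefl o)) ⟩
    1# * a + 0# * (a * a)                 ≈⟨ solve 1 (λ a →
                                               con (+ 1) :* a :+ con (+ 0) :* (a :* a) := a) refl a ⟩
    a                                     ∎

  -- Columns of different pairs are separated by a leading row, extra columns by their apexes, and a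
  -- column of a pair from an extra column by its leading row. Within one pair the two rows have a
  -- determinant equal, up to sign, to a - b.
  entry-independent : ∀ {s t} k l → s ≢ t →
    (∀ r → k * entry r (point s) + l * entry r (point t) ≈ 0#) → k ≈ 0#
  entry-independent {inj₁ (o , i)} {inj₁ (o′ , j)} k l s≢t eq with o ≟ₒ o′
  ... | no o≢o′ = isolate (δ-refl _≟ₒ_ o) (δ-≢ _≟ₒ_ (o≢o′ ∘ ≡.sym)) (eq (0F , o))
  ... | yes ≡.refl = xy≈0⇒y≈0 a-b≉0
      (modulo lead (modulo trail (solve 4 (λ a b k l →
        (a :- b) :* k := (con (+ 0) :+ (:- b) :* (k :* con (+ 1) :+ l :* con (+ 1) :- con (+ 0)))
          :+ con (+ 1) :* (k :* a :+ l :* b :- con (+ 0))) refl a b k l)))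
    where
    a b : Carrier
    a = element i
    b = element j

    a-b≉0 : a - b ≉ 0#
    a-b≉0 a-b≈0 = s≢t (cong (λ m → inj₁ (o , m)) (element-injective (x-y≈0⇒x≈y a-b≈0)))

    lead : k * 1# + l * 1# ≈ 0#
    lead = trans (sym (+-cong (*-congˡ (δ-refl _≟ₒ_ o)) (*-congˡ (δ-refl _≟ₒ_ o)))) (eq (0F , o))

    trail : k * a + l * b ≈ 0#
    trail = trans (sym (+-cong (*-congˡ (trailing-own o a)) (*-congˡ (trailing-own o b))))
      (eq (1F , o))
  entry-independent {inj₁ (o , _)} {inj₂ _} k l _ eq = isolate (δ-refl _≟ₒ_ o) refl (eq (0F , o))
  -- The column of the pair may be nonzero in the trailing row of the apex, so its coefficient `l`
  -- is shown to vanish first, by its leading row.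
  entry-independent {inj₂ e} {inj₁ (o , _)} k l _ eq = isolate {l = 1#} (δ-refl _≟ₒ_ (apex e)) refl
    (begin
      k * d + 1# * 0#    ≈⟨ solve 3 (λ k d m → k :* d :+ con (+ 1) :* con (+ 0)
                              := k :* d :+ con (+ 0) :* m) refl k d _ ⟩
      k * d + 0# * _     ≈⟨ +-congˡ (*-congʳ l≈0) ⟨
      k * d + l * _      ≈⟨ eq (1F , apex e) ⟩
      0#                 ∎)
    where
    d : Carrier
    d = trailing (apex e) (inj₂ e)

    l≈0 : l ≈ 0#
    l≈0 = isolate (δ-refl _≟ₒ_ o) refl (trans (+-comm _ _) (eq (0F , o)))
  entry-independent {inj₂ e} {inj₂ e′} k l s≢t eq = isolate (δ-refl _≟ₒ_ (apex e))
    (δ-≢ _≟ₒ_ (λ eq → s≢t (cong inj₂ (apex-injective (≡.sym eq))))) (eq (1F , apex e))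

  at-row : ∀ {f : Fin 2 × O → Carrier} → (∀ i → f (rows.to i) ≈ 0#) → ∀ r → f r ≈ 0#
  at-row {f} eq r = trans (reflexive (cong f (≡.sym (rows.strictlyInverseˡ r)))) (eq (rows.from r))

  H-distance≥3 : ∀ x → Codeword H x → Nonzero x → ∀ d → WeightAtMost d x → 3 ≤ d
  H-distance≥3 = distance≥3 H
    (λ j k eq → entry-nonzero _ k (at-row {λ r → k * entry r (point (columns.to j))} eq))
    (λ {j} {j′} k l j≢j′ eq → entry-independent k l (j≢j′ ∘ ↔-to-injective columns)
      (at-row {λ r → k * entry r (point (columns.to j)) + l * entry r (point (columns.to j′))} eq))

  leading-unshared : ∀ {o o′} s → leading o (point s) ≉ 0# → leading o′ (point s) ≉ 0# → o ≡ o′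
  leading-unshared {o} {o′} (inj₁ (o″ , _)) l≉0 l′≉0 with o″ ≟ₒ o | o″ ≟ₒ o′
  ... | yes ≡.refl | yes ≡.refl = ≡.refl
  ... | no _       | _          = contradiction refl l≉0
  ... | yes _      | no _       = contradiction refl l′≉0
  leading-unshared (inj₂ _) l≉0 _ = contradiction refl l≉0

  H-covering-bound : ∀ R′ → (∀ v → CombAtMost H R′ v) → R ≤ R′
  H-covering-bound = covering-bound H ρ (λ {i} {i′} {j} h≉0 h′≉0 →
    ↔-to-injective pieces (leading-unshared (columns.to j) (h≉0 ∘ trans (H-ρ i j)) (h′≉0 ∘ trans (H-ρ i′ j))))
    where
    ρ : Fin R → Fin (2 ℕ.* R)
    ρ i = rows.from (0F , Inverse.to pieces i)

    H-ρ : ∀ i j → H (ρ i) j ≈ leading (Inverse.to pieces i) (point (columns.to j))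
    H-ρ i j = reflexive (cong (λ r → entry r (point (columns.to j)))
      (rows.strictlyInverseˡ (0F , Inverse.to pieces i)))

  module _ (4≤q : 4 ≤ q) where

    -- The columns of the final piece lie on a line.
    weight-three : ∃ λ x → Codeword H x × Nonzero x × WeightAtMost 3 x
    weight-three with third-element 4≤q
    ... | t , t≉0 , t-1≉0 = vec ys , codeword , nonzero
      , indices ys , ∣indices∣≤length ys , vec-supported ys
      where
      on-line : Carrier → Fin (R ℕ.* q ℕ.+ e)
      on-line a = position (inj₁ (final , a))

      ys : List (Carrier × Fin (R ℕ.* q ℕ.+ e))
      -- The affine dependence of t, 0 and 1: the weights 1, t - 1, -t have sum zero and first
      -- moment t - t = 0. Since t differs from 0 and 1, the coordinate at `on-line t` is exactly 1.
      ys = (1# , on-line t) ∷ (t - 1# , on-line 0#) ∷ (- t , on-line 1#) ∷ []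

      on-line-injective : ∀ {a b} → on-line a ≡ on-line b → a ≈ b
      on-line-injective {a} {b} eq = begin
        a
          ≈⟨ trailing-own final a ⟨
        entry r (inj₁ (final , a))
          ≡⟨ cong (λ r → entry r (inj₁ (final , a))) (rows.strictlyInverseˡ r) ⟨
        entry (rows.to (rows.from r)) (inj₁ (final , a))
          ≈⟨ H-position (rows.from r) _ ⟨
        H (rows.from r) (on-line a)
          ≡⟨ cong (H (rows.from r)) eq ⟩
        H (rows.from r) (on-line b)
          ≈⟨ H-position (rows.from r) _ ⟩
        entry (rows.to (rows.from r)) (inj₁ (final , b))
          ≡⟨ cong (λ r → entry r (inj₁ (final , b))) (rows.strictlyInverseˡ r) ⟩
        entry r (inj₁ (final , b))
          ≈⟨ trailing-own final b ⟩
        b ∎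
        where
        r : Fin 2 × O
        r = 1F , final

      nonzero : Nonzero (vec ys)
      nonzero x≈0 = 1≉0 (begin
        1#                                       ≈⟨ +-identityʳ 1# ⟨
        1# + 0#                                  ≈⟨ +-congˡ (trans (+-identityˡ _) (+-identityˡ 0#)) ⟨
        1# + (0# + (0# + 0#))                    ≡⟨ ≡.cong₂ _+_ (single-≡ (on-line t) 1#)
                                                      (≡.cong₂ (λ a b → a + (b + 0#))
                                                        (single-≢ (t - 1#) (t≉0 ∘ sym ∘ on-line-injective))
                                                        (single-≢ (- t) (λ eq → t-1≉0 (x≈y⇒x-y≈0
                                                          (sym (on-line-injective eq)))))) ⟨
        vec ys (on-line t)                       ≈⟨ x≈0 (on-line t) ⟩
        0#                                       ∎)

      entries : ∀ r → 1# * entry r (inj₁ (final , t)) + ((t - 1#) * entry r (inj₁ (final , 0#))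
        + (- t * entry r (inj₁ (final , 1#)) + 0#)) ≈ 0#
      entries (0F , o) = solve 2 (λ t d → con (+ 1) :* d
        :+ ((t :- con (+ 1)) :* d :+ ((:- t) :* d :+ con (+ 0))) := con (+ 0)) refl t _
      -- The second moment t² - t of these weights does not vanish, but it enters only multiplied by
      -- a link of the final piece, which is zero.
      entries (1F , o) = modulo (link-final o) (solve 3 (λ t d l →
        con (+ 1) :* (d :* t :+ l :* (t :* t))
          :+ ((t :- con (+ 1)) :* (d :* con (+ 0) :+ l :* (con (+ 0) :* con (+ 0)))
          :+ ((:- t) :* (d :* con (+ 1) :+ l :* (con (+ 1) :* con (+ 1))) :+ con (+ 0)))
          := con (+ 0) :+ (t :* t :- t) :* (l :- con (+ 0))) refl t _ _)

      codeword : Codeword H (vec ys)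
      codeword i = begin
        (H · vec ys) i
          ≈⟨ ·-vec H ys i ⟩
        combine (H i) ys
          ≈⟨ +-cong (*-congˡ (H-position i _)) (+-cong (*-congˡ (H-position i _))
               (+-congʳ (*-congˡ (H-position i _)))) ⟩
        1# * entry (rows.to i) _ + ((t - 1#) * entry (rows.to i) _ + (- t * entry (rows.to i) _ + 0#))
          ≈⟨ entries (rows.to i) ⟩
        0# ∎

    -- Covering every vector makes H surjective, which gives the rank. The bound on R lets the
    -- codeword of weight three represent the zero column within R columns, so ℓ = 1 is attained by
    -- the partition into singletons.
    code : 3 ≤ R → Saturating →
      FullRowRank H × MinDistance H 3 × CoveringRadius H R × Σ ℕ (λ l → 1 ≤ l × RlObject H R l)
    code 3≤R saturating =
        surjective⇒FullRowRank H (λ v → let _ , _ , x , _ , Hx≈v = covers v in x , Hx≈v)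
      , (H-distance≥3 , weight-three)
      , (covers , H-covering-bound)
      , 1 , s≤s z≤n , ℕ.≤-trans (s≤s z≤n) 3≤R , discrete , partition
      where
      covers : ∀ v → CombAtMost H R v
      covers v with saturating (λ o → v (rows.from (0F , o))) (λ o → v (rows.from (1F , o)))
      ... | xs , len , lead , trail = H-covers v xs len
        λ { (0F , o) → lead o ; (1F , o) → trail o }

      partition : IsRlPartition H R 1 discrete
      partition with weight-three
      ... | x , Hx≈0 , x≉0 , T , ∣T∣≤3 , supp =
        discrete-partition H covers Hx≈0 x≉0 (T , ℕ.≤-trans ∣T∣≤3 3≤R , supp)

open import Data.Nat using (_+_; _*_)

theorem20 : ∀ {c ℓ : Level} (q : ℕ) (F : FiniteField c ℓ q) (R : ℕ) →
    4 ≤ R → 4 ≤ q →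
    let open CodeDefs F in
    Σ (Matrix (2 * R) (R * q + ceil3 R)) λ H →
    FullRowRank H × MinDistance H 3 × CoveringRadius H R ×
    Σ ℕ (λ l → 1 ≤ l × RlObject H R l)
theorem20 q F R 4≤R 4≤q
  with Chains.saturating-scheme F 4≤q (ℕ.≤-trans (s≤s (s≤s z≤n)) 4≤R)
... | S , saturating = SchemeCode.H F S
  , SchemeCode.code F S 4≤q (ℕ.≤-trans (ℕ.n≤1+n 3) 4≤R) saturating
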